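{- Every $(2K_2, K_4, C_5)$-free graph is recolorable.
   Context: All graphs are finite and simple. For graphs $F_1,\dots,F_t$, a graph $G$ is $(F_1,\dots,F_t)$-free if no induced subgraph of $G$ is isomorphic to any $F_j$. $2K_2$ is the disjoint union of two copies of $K_2$ (two disjoint edges on four vertices with no other edges), $K_4$ is the complete graph on four vertices, $C_5$ is the cycle on five vertices. An $\ell$-coloring of $G$ is a map $V(G)\to\{1,\dots,\ell\}$ giving adjacent vertices distinct colors (not all colors need be used); $\chi(G)$ is the least $\ell$ for which an $\ell$-coloring exists. The reconfiguration graph $\mathcal{R}_\ell(G)$ has the $\ell$-colorings of $G$ as vertices, with two colorings adjacent whenever they differ on exactly one vertex of $G$. The graph $G$ is recolorable if $\mathcal{R}_\ell(G)$ is connected for every $\ell>\chi(G)$. -}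

module Defs where

open import Data.Fin using (Fin; zero; suc; toℕ; splitAt)
open import Data.Fin.Properties using (_≟_)
open import Data.Fin.Subset using (Subset; _∈_)
open import Data.List using (List)
open import Data.List.Relation.Unary.All using (All)
open import Data.Nat using (ℕ; suc; _+_; _%_; _≤_; _>_)
import Data.Nat.Properties as ℕ
open import Data.Product using (Σ; ∃; ∃!; _×_; _,_; proj₁)
open import Data.Sum using (_⊎_; inj₁; inj₂; swap; [_,_])
open import Data.Sum.Relation.Binary.Pointwise
  using (Pointwise; inj₁; inj₂; ⊎-symmetric; ⊎-decidable)
open import Function using (_∘_)
open import Function.Bundles using (_↔_; _⇔_; module Inverse)
open import Level using (0ℓ)
open import Relation.Binary.Construct.Closure.ReflexiveTransitive using (Star)
open import Relation.Binary.Core using (Rel)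
open import Relation.Binary.Definitions using (Decidable; Symmetric)
open import Relation.Binary.PropositionalEquality
  using (_≡_; _≢_; _≗_; refl; sym)
open import Relation.Nullary using (¬_)
open import Relation.Nullary.Decidable using (¬?; _⊎-dec_)

-- Finite simple graphs, with vertices labelled by Fin order.  Adjacency is
-- required to be decidable, which is automatic classically.
record Graph : Set₁ where
  field
    order      : ℕ
    Adj        : Rel (Fin order) 0ℓ
    Adj?       : Decidable Adj
    Adj-sym    : Symmetric Adj
    Adj-irrefl : ∀ v → ¬ Adj v v

  Vertex : Set
  Vertex = Fin order

open Graph public

K : ℕ → Graph
K n = record
  { order      = n
  ; Adj        = _≢_
  ; Adj?       = λ u v → ¬? (u ≟ v)
  ; Adj-sym    = _∘ sym
  ; Adj-irrefl = λ _ v≢v → v≢v refl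
  }

-- Disjoint union: Pointwise never relates an inj₁ to an inj₂.
infixr 5 _⊍_

_⊍_ : Graph → Graph → Graph
G ⊍ H = record
  { order      = order G + order H
  ; Adj        = λ u v → Pointwise (Adj G) (Adj H) (side u) (side v)
  ; Adj?       = λ u v → ⊎-decidable (Adj? G) (Adj? H) (side u) (side v)
  ; Adj-sym    = ⊎-symmetric (Adj-sym G) (Adj-sym H)
  ; Adj-irrefl = λ v → irrefl (side v)
  }
  where
  side : Fin (order G + order H) → Vertex G ⊎ Vertex H
  side = splitAt (order G)

  irrefl : ∀ x → ¬ Pointwise (Adj G) (Adj H) x x
  irrefl (inj₁ v) (inj₁ e) = Adj-irrefl G v e
  irrefl (inj₂ v) (inj₂ e) = Adj-irrefl H v e

2K₂ : Graph
2K₂ = K 2 ⊍ K 2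

C₅ : Graph
C₅ = record
  { order      = 5
  ; Adj        = λ u v → Next u v ⊎ Next v u
  ; Adj?       = λ u v → next? u v ⊎-dec next? v u
  ; Adj-sym    = swap
  ; Adj-irrefl = λ v → [ irrefl v , irrefl v ]
  }
  where
  Next : Rel (Fin 5) 0ℓ
  Next u v = toℕ v ≡ suc (toℕ u) % 5

  next? : Decidable Next
  next? u v = toℕ v ℕ.≟ suc (toℕ u) % 5

  irrefl : ∀ v → ¬ Next v v
  irrefl zero                         ()
  irrefl (suc zero)                   ()
  irrefl (suc (suc zero))             ()
  irrefl (suc (suc (suc zero)))       ()
  irrefl (suc (suc (suc (suc zero)))) ()

-- An isomorphism from F to the subgraph of G induced by S.
record _≅_[_] (F G : Graph) (S : Subset (order G)) : Set where
  field
    bijection : Vertex F ↔ Σ (Vertex G) (_∈ S)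

  image : Vertex F → Vertex G
  image v = proj₁ (Inverse.to bijection v)

  field
    adjacency : ∀ u v → Adj F u v ⇔ Adj G (image u) (image v)

Free : List Graph → Graph → Set₁
Free Fs G = All (λ F → ¬ ∃ λ S → F ≅ G [ S ]) Fs

record Colouring (G : Graph) (ℓ : ℕ) : Set where
  field
    colour : Vertex G → Fin ℓ
    proper : ∀ {u v} → Adj G u v → colour u ≢ colour v

open Colouring public

IsChromaticNumber : Graph → ℕ → Set
IsChromaticNumber G k = Colouring G k × (∀ j → Colouring G j → k ≤ j)

-- Adjacency in the reconfiguration graph.
Recolour : ∀ {G ℓ} → Rel (Colouring G ℓ) 0ℓ
Recolour α β = ∃! _≡_ λ v → colour α v ≢ colour β v

-- Colourings are identified when they assign the same colour to every vertex.
-- Without function extensionality this is not _≡_, so a path from α to β is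
-- allowed to end at any γ representing the same colouring as β.
ReconfigurationGraphConnected : Graph → ℕ → Set
ReconfigurationGraphConnected G ℓ =
  ∀ (α β : Colouring G ℓ) →
  ∃ λ γ → Star Recolour α γ × (colour γ ≗ colour β)

Recolourable : Graph → Set
Recolourable G =
  ∀ χ → IsChromaticNumber G χ → ∀ ℓ → ℓ > χ → ReconfigurationGraphConnected G ℓ

{-# OPTIONS --safe #-}

-- It suffices to show that every ℓ-colouring of a k-colourable graph of the class, ℓ > k, can be
-- recoloured so that some colour disappears: an arbitrary independent set may then take
-- that colour, and one inducts on a k-colouring γ by fixing one of its classes.
--
-- Call the classes of the current colouring rows and those of γ columns.  By
-- 2K₂-freeness, of two diagonals in a 2 × 2 block of cells one spans no edge, so cells can be
-- moved between rows.  For k ≤ 3 this always brings a row inside a single column, which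
-- reduces k, except in a cyclic configuration that contains 2K₂.
--
-- For ℓ ≥ 5 a vertex whose neighbourhood is contained in that of a non-neighbour can be
-- deleted, as it can follow that non-neighbour.  A graph of the class without such pairs
-- is 3-colourable, or the complement of C₇, or the complement of the square of C₁₁: a
-- failed attempt to extend a 3-colouring to a further vertex exhibits the complement of
-- C₇, and further vertices are governed by their possible adjacencies to it.  In the two
-- exceptional graphs every colour class lies in an independent set with 3-colourable
-- complement.
module Submission where

open import Defs hiding (Vertex; order; Adj; Adj?; Adj-sym; Adj-irrefl)
open import Data.Bool as Bool using (Bool; true; false; _∨_; _∧_)
import Data.Bool.Properties as Bool
open import Data.Empty using (⊥; ⊥-elim)
open import Data.Fin using (Fin; zero; suc; toℕ; fromℕ<; #_)
open import Data.Fin.Properties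
  using (_≟_; any?; all?; ¬∀⟶∃¬; suc-injective; toℕ-injective; toℕ<n)
open import Data.Fin.Subset as Subset using (Subset)
open import Data.List as List using (List; []; _∷_; allFin)
import Data.List.Membership.DecPropositional as Membership
open import Data.List.Membership.Propositional using (_∈_)
open import Data.List.Membership.Propositional.Properties using (∈-allFin; ∈-filter⁺)
open import Data.List.Properties using (filter-notAll)
open import Data.List.Relation.Unary.All as All using (All)
open import Data.List.Relation.Unary.Any as Any using (here; there)
open import Data.Nat as ℕ using (ℕ; zero; suc; _≤_; _<_; z≤n; s≤s)
open import Data.Nat.DivMod using (m%n<n)
import Data.Nat.Properties as ℕ
open import Data.Product using (Σ; ∃; ∃₂; _×_; _,_; proj₁; proj₂)
open import Data.Sum using (_⊎_; inj₁; inj₂; [_,_])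
open import Data.Unit using (⊤; tt)
open import Data.Vec as Vec using (Vec; []; _∷_; lookup; head; tail)
import Data.Vec.Properties as Vec
import Data.Vec.Properties.WithK as Vec
open import Function using (_∘_; id; case_of_)
open import Function.Bundles using (mk↔ₛ′; mk⇔)
open import Level using (0ℓ)
open import Relation.Binary.Construct.Closure.ReflexiveTransitive using (Star; ε; _◅_; _◅◅_)
open import Relation.Binary.Core using (Rel)
import Relation.Binary.Definitions as Binary
open import Relation.Binary.PropositionalEquality
  using (_≡_; _≢_; _≗_; refl; sym; trans; cong; cong₂; subst)
open import Relation.Nullary using (¬_; Dec; yes; no; does; contradiction)
open import Relation.Nullary.Decidable
  using (¬?; decidable-stable; dec-true; dec-false; from-yes; _×-dec_; _→-dec_; _⊎-dec_)
open import Relation.Unary using (Pred; Decidable; _⊆_)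

-- With three columns, a cell of row `c` linked to row `d` has only two columns to be linked to, so
-- a missing link forces another one, and 2K₂-freeness carries the choice on to the next column.
-- With four columns a missing link decides nothing, which is why larger palettes are led back to
-- three columns and at most one further class. Hence the bound five: three columns take four
-- colours, and the two exceptional graphs, which are not 3-colourable, have a fourth class that is
-- set aside with a colour of its own.
--
-- Everything happens inside one fixed graph and one fixed set of ℓ colours. The current subgraph
-- `U` and palette `L` are predicates, and colourings are total functions constrained only on `U`;
-- setting aside a class or deleting a vertex shrinks these predicates, and a path for the smaller
-- pair lifts to the larger one. Losing a colour is the property carried through these reductions
-- because it concerns a single colouring.
--
-- The possible adjacencies of a further vertex to the complement of C₇ form a finite list, which is
-- computed by evaluation.

open module FinMembership {n} = Membership (_≟_ {n}) using (_∈?_)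

-- Palettes with a guaranteed number of colours

_∖_ : ∀ {A : Set} → Pred A 0ℓ → Pred A 0ℓ → Pred A 0ℓ
(P ∖ Q) x = P x × ¬ Q x

_∖?_ : ∀ {A : Set} {P Q : Pred A 0ℓ} → Decidable P → Decidable Q → Decidable (P ∖ Q)
(P? ∖? Q?) x = P? x ×-dec ¬? (Q? x)

-- Since a palette is only a predicate, its size is bounded below by successive witnesses, each
-- removed before the next is chosen.
Many : ∀ {ℓ} → ℕ → Pred (Fin ℓ) 0ℓ → Set
Many zero    L = ⊤
Many (suc m) L = ∃ λ c → L c × Many m (L ∖ (_≡ c))

many-mono : ∀ {ℓ} m {L M : Pred (Fin ℓ) 0ℓ} → L ⊆ M → Many m L → Many m M
many-mono zero    _   _             = tt
many-mono (suc m) L⊆M (c , c∈L , r) =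
  c , L⊆M c∈L , many-mono m (λ (p , q) → L⊆M p , q) r

many-≤ : ∀ {ℓ m k} {L : Pred (Fin ℓ) 0ℓ} → m ≤ k → Many k L → Many m L
many-≤ z≤n     _             = tt
many-≤ (s≤s p) (c , c∈L , r) = c , c∈L , many-≤ p r

many-remove : ∀ {ℓ} m {L : Pred (Fin ℓ) 0ℓ} → Many (suc m) L → ∀ c → Many m (L ∖ (_≡ c))
many-remove zero    _             c = tt
many-remove (suc m) (d , d∈L , r) c with d ≟ c
... | yes refl = r
... | no  d≢c  = d , (d∈L , d≢c) ,
  many-mono m (λ ((p , q) , s) → (p , s) , q) (many-remove m r c)

many-image : ∀ {ℓ k} m {L : Pred (Fin ℓ) 0ℓ} {M : Pred (Fin k) 0ℓ} (h : Fin ℓ → Fin k) →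
             (∀ {x y} → h x ≡ h y → x ≡ y) → (∀ {x} → L x → M (h x)) → Many m L → Many m M
many-image zero    _ _   _   _             = tt
many-image (suc m) h inj L→M (c , c∈L , r) =
  h c , L→M c∈L , many-image m h inj (λ (p , q) → L→M p , q ∘ inj) r

many-full : ∀ ℓ → Many {ℓ} ℓ (λ _ → ⊤)
many-full zero    = tt
many-full (suc ℓ) =
  zero , tt , many-image ℓ suc suc-injective (λ _ → tt , λ ()) (many-full ℓ)

-- Recolouring an induced subgraph within a palette

module Recolouring (G : Graph) where

  open Graph G renaming
    (Vertex to V; Adj to E; Adj? to E?; Adj-sym to E-sym; Adj-irrefl to E-irrefl) public

  Independent : Pred V 0ℓ → Set
  Independent S = ∀ {u v} → S u → S v → ¬ E u v

  independent-⊆ : ∀ {S T} → S ⊆ T → Independent T → Independent S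
  independent-⊆ S⊆T ind u∈S v∈S = ind (S⊆T u∈S) (S⊆T v∈S)

  independent-insert : ∀ {S x} → Independent S → (∀ {u} → S u → ¬ E x u) →
                       Independent (λ u → u ≡ x ⊎ S u)
  independent-insert ind far (inj₁ refl) (inj₁ refl) = E-irrefl _
  independent-insert ind far (inj₁ refl) (inj₂ v∈S)  = far v∈S
  independent-insert ind far (inj₂ u∈S)  (inj₁ refl) = far u∈S ∘ E-sym
  independent-insert ind far (inj₂ u∈S)  (inj₂ v∈S)  = ind u∈S v∈S

  ProperOn : {C : Set} → Pred V 0ℓ → (V → C) → Set
  ProperOn U f = ∀ {u v} → U u → U v → E u v → f u ≢ f v

  Linked : Pred V 0ℓ → Pred V 0ℓ → Set
  Linked P Q = ∃₂ λ x y → P x × Q y × E x y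

  Linked? : ∀ {P Q} → Decidable P → Decidable Q → Dec (Linked P Q)
  Linked? P? Q? = any? λ x → any? λ y → P? x ×-dec Q? y ×-dec E? x y

  module _ {ℓ : ℕ} where

    C : Set
    C = Fin ℓ

    record Proper (U : Pred V 0ℓ) (L : Pred C 0ℓ) (f : V → C) : Set where
      constructor _,_
      field
        palette : ∀ {u} → U u → L (f u)
        separated : ProperOn U f

    open Proper public

    -- A vertex may receive the colour that it already has; such null steps are dropped when a path
    -- is carried over to the reconfiguration graph.
    record Step (U : Pred V 0ℓ) (L : Pred C 0ℓ) (f g : V → C) : Set where
      field
        vertex  : V
        active  : U vertex
        allowed : L (g vertex)
        free    : ∀ {w} → U w → E vertex w → f w ≢ g vertex
        others  : ∀ {w} → w ≢ vertex → g w ≡ f w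

    open Step public

    Reach : Pred V 0ℓ → Pred C 0ℓ → Rel (V → C) 0ℓ
    Reach U L = Star (Step U L)

    Shrink : Pred V 0ℓ → Pred C 0ℓ → (V → C) → Set
    Shrink U L f = ∃₂ λ g c → Reach U L f g × L c × (∀ {u} → U u → g u ≢ c)

    shrink-reach : ∀ {U L f g} → Reach U L f g → Shrink U L g → Shrink U L f
    shrink-reach r (h , c , s , rest) = h , c , r ◅◅ s , rest

    step-proper : ∀ {U L f g} → Step U L f g → Proper U L f → Proper U L g
    step-proper {U} {L} {f} {g} s (pal , prop) = pal′ , prop′
      where
      pal′ : ∀ {u} → U u → L (g u)
      pal′ {u} u∈U with u ≟ vertex s
      ... | yes refl = allowed s
      ... | no  u≢v  = subst L (sym (others s u≢v)) (pal u∈U)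

      prop′ : ProperOn U g
      prop′ {u} {w} u∈U w∈U e gu≡gw with u ≟ vertex s | w ≟ vertex s
      ... | yes refl | yes refl = E-irrefl _ e
      ... | yes refl | no  w≢v  = free s w∈U e (trans (sym (others s w≢v)) (sym gu≡gw))
      ... | no  u≢v  | yes refl = free s u∈U (E-sym e) (trans (sym (others s u≢v)) gu≡gw)
      ... | no  u≢v  | no  w≢v  =
        prop u∈U w∈U e (trans (sym (others s u≢v)) (trans gu≡gw (others s w≢v)))

    reach-proper : ∀ {U L f g} → Reach U L f g → Proper U L f → Proper U L g
    reach-proper ε       p = p
    reach-proper (s ◅ r) p = reach-proper r (step-proper s p)

    step-outside : ∀ {U L f g v} → Step U L f g → ¬ U v → g v ≡ f v
    step-outside s v∉U = others s λ { refl → v∉U (active s) }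

    reach-outside : ∀ {U L f g v} → Reach U L f g → ¬ U v → g v ≡ f v
    reach-outside ε       _   = refl
    reach-outside (s ◅ r) v∉U = trans (reach-outside r v∉U) (step-outside s v∉U)

    step-sym : ∀ {U L f g} → Proper U L f → Step U L f g → Step U L g f
    step-sym {U} {L} {f} {g} (pal , prop) s = record
      { vertex  = vertex s
      ; active  = active s
      ; allowed = pal (active s)
      ; free    = free′
      ; others  = λ w≢v → sym (others s w≢v)
      }
      where
      free′ : ∀ {w} → U w → E (vertex s) w → g w ≢ f (vertex s)
      free′ {w} w∈U e gw≡fv with w ≟ vertex s
      ... | yes refl = E-irrefl _ e
      ... | no  w≢v  = prop (active s) w∈U e (trans (sym gw≡fv) (others s w≢v))

    reach-sym : ∀ {U L f g} → Proper U L f → Reach U L f g → Reach U L g f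
    reach-sym p ε       = ε
    reach-sym p (s ◅ r) = reach-sym (step-proper s p) r ◅◅ (step-sym p s ◅ ε)

    -- The vertices of `U` outside `W` never move and hold colours outside `M`, so they cannot block
    -- a step inside `W`.
    reach-extend : ∀ {U W : Pred V 0ℓ} {L M f g} → Decidable W → W ⊆ U → M ⊆ L →
                   (∀ {u} → U u → ¬ W u → ¬ M (f u)) → Reach W M f g → Reach U L f g
    reach-extend                 W? W⊆U M⊆L out ε       = ε
    reach-extend {U} {W} {L} {M} {f} W? W⊆U M⊆L out (_◅_ {j = h} s r) =
      s′ ◅ reach-extend W? W⊆U M⊆L out′ r
      where
      free′ : ∀ {w} → U w → E (vertex s) w → f w ≢ h (vertex s)
      free′ {w} w∈U e with W? w
      ... | yes w∈W = free s w∈W e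
      ... | no  w∉W = λ eq → out w∈U w∉W (subst M (sym eq) (allowed s))

      s′ : Step U L f h
      s′ = record
        { vertex = vertex s ; active = W⊆U (active s) ; allowed = M⊆L (allowed s)
        ; free = free′ ; others = others s }

      out′ : ∀ {u} → U u → ¬ W u → ¬ M (h u)
      out′ u∈U u∉W = out u∈U u∉W ∘ subst M (step-outside s u∉W)

    update : (V → C) → V → C → V → C
    update f v c w with w ≟ v
    ... | yes _ = c
    ... | no  _ = f w

    update-≡ : ∀ f v c → update f v c v ≡ c
    update-≡ f v c with v ≟ v
    ... | yes _   = refl
    ... | no  v≢v = contradiction refl v≢v

    update-≢ : ∀ f {v} c {w} → w ≢ v → update f v c w ≡ f w
    update-≢ f {v} c {w} w≢v with w ≟ v
    ... | yes w≡v = contradiction w≡v w≢v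
    ... | no  _   = refl

    update-step : ∀ {U : Pred V 0ℓ} {L : Pred C 0ℓ} {f v c} → U v → L c →
                  (∀ {w} → U w → E v w → f w ≢ c) → Step U L f (update f v c)
    update-step {L = L} {f} {v} {c} v∈U c∈L fr = record
      { vertex  = v
      ; active  = v∈U
      ; allowed = subst L (sym (update-≡ f v c)) c∈L
      ; free    = λ w∈U e eq → fr w∈U e (trans eq (update-≡ f v c))
      ; others  = update-≢ f c
      }

    record Swept (U : Pred V 0ℓ) (L : Pred C 0ℓ) (S : Pred V 0ℓ) (c : C) (f : V → C) : Set where
      field
        result  : V → C
        reaches : Reach U L f result
        swept   : ∀ {v} → S v → result v ≡ c
        kept    : ∀ {v} → ¬ S v → result v ≡ f v

    open Swept public

    sweep : ∀ {U : Pred V 0ℓ} {L : Pred C 0ℓ} {S : Pred V 0ℓ} {c f} → Decidable S →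
            S ⊆ U → Independent S → L c →
            (∀ {s w} → S s → U w → E s w → f w ≢ c) → Swept U L S c f
    sweep {U} {L} {S} {c} {f} S? S⊆U ind c∈L fr = record
      { result  = proj₁ done
      ; reaches = proj₁ (proj₂ done)
      ; swept   = λ {v} v∈S → proj₁ (proj₂ (proj₂ done)) v∈S (∈-allFin v)
      ; kept    = proj₁ (proj₂ (proj₂ (proj₂ done)))
      }
      where
      -- Vertices already moved lie in the independent set `S`, so they never block a later move;
      -- the last component says that they keep the colour `c`.
      go : ∀ xs f → (∀ {s w} → S s → U w → E s w → f w ≢ c) →
           ∃ λ g → Reach U L f g × (∀ {v} → S v → v ∈ xs → g v ≡ c) ×
                   (∀ {v} → ¬ S v → g v ≡ f v) × (∀ {v} → f v ≡ c → g v ≡ c)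
      go []       f fr = f , ε , (λ _ ()) , (λ _ → refl) , id
      go (x ∷ xs) f fr with S? x
      ... | no  x∉S =
        let g , r , sw , ke , st = go xs f fr
        in  g , r , (λ { v∈S (here refl) → contradiction v∈S x∉S
                       ; v∈S (there i)   → sw v∈S i }) , ke , st
      ... | yes x∈S =
        let g , r , sw , ke , st = go xs (update f x c) fr′
        in  g , update-step (S⊆U x∈S) c∈L (fr x∈S) ◅ r
              , (λ { v∈S (here refl) → st (update-≡ f x c)
                   ; v∈S (there i)   → sw v∈S i })
              , (λ {v} v∉S → trans (ke v∉S) (update-≢ f c λ { refl → v∉S x∈S }))
              , (λ {v} fv≡c → st (stays v fv≡c))
        where
        stays : ∀ v → f v ≡ c → update f x c v ≡ c
        stays v fv≡c with v ≟ x
        ... | yes _ = refl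
        ... | no  _ = fv≡c

        fr′ : ∀ {s w} → S s → U w → E s w → update f x c w ≢ c
        fr′ {s} {w} s∈S w∈U e with w ≟ x
        ... | yes refl = λ _ → ind s∈S x∈S e
        ... | no  _    = fr s∈S w∈U e

      done = go (allFin order) f fr

    -- A colour class contained in an independent set S can grow to all of S;
    -- then S and its colour can be set aside.
    shrink-class : ∀ {U : Pred V 0ℓ} {L : Pred C 0ℓ} {S : Pred V 0ℓ} {c f} →
                   Decidable U → Decidable S → Proper U L f →
                   (∀ {u v} → U u → U v → S u → S v → ¬ E u v) → L c →
                   (∀ {u} → U u → f u ≡ c → S u) →
                   (∀ g → Proper (U ∖ S) (L ∖ (_≡ c)) g → Shrink (U ∖ S) (L ∖ (_≡ c)) g) →
                   Shrink U L f
    shrink-class {U} {L} {S} {c} {f} U? S? (pal , prop) ind c∈L class rest =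
      let h , d , r , (d∈L , d≢c) , miss = rest (result sw) (pal′ , prop′)
          r′ = reach-extend (U? ∖? S?) proj₁ proj₁ out r
      in  h , d , reaches sw ◅◅ r′ , d∈L , miss′ d≢c r miss
      where
      sw : Swept U L (λ v → U v × S v) c f
      sw = sweep (λ v → U? v ×-dec S? v) proj₁ (λ (p , q) (p′ , q′) → ind p p′ q q′) c∈L
             (λ (s∈U , s∈S) w∈U e fw≡c → ind s∈U w∈U s∈S (class w∈U fw≡c) e)

      keep : ∀ {u} → (U ∖ S) u → result sw u ≡ f u
      keep (_ , u∉S) = kept sw (u∉S ∘ proj₂)

      pal′ : ∀ {u} → (U ∖ S) u → (L ∖ (_≡ c)) (result sw u)
      pal′ p@(u∈U , u∉S) = subst (L ∖ (_≡ c)) (sym (keep p)) (pal u∈U , u∉S ∘ class u∈U)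

      prop′ : ProperOn (U ∖ S) (result sw)
      prop′ p q e eq = prop (proj₁ p) (proj₁ q) e (trans (sym (keep p)) (trans eq (keep q)))

      inS : ∀ {u} → U u → ¬ (U ∖ S) u → S u
      inS {u} u∈U no∖ with S? u
      ... | yes u∈S = u∈S
      ... | no  u∉S = contradiction (u∈U , u∉S) no∖

      out : ∀ {u} → U u → ¬ (U ∖ S) u → ¬ (L ∖ (_≡ c)) (result sw u)
      out u∈U no∖ (_ , ≢c) = ≢c (swept sw (u∈U , inS u∈U no∖))

      miss′ : ∀ {d h} → d ≢ c → Reach (U ∖ S) (L ∖ (_≡ c)) (result sw) h →
              (∀ {u} → (U ∖ S) u → h u ≢ d) → ∀ {u} → U u → h u ≢ d
      miss′ d≢c r miss {u} u∈U hu≡d with S? u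
      ... | no  u∉S = miss (u∈U , u∉S) hu≡d
      ... | yes u∈S = d≢c (trans (sym hu≡d)
              (trans (reach-outside r (λ p → proj₂ p u∈S)) (swept sw (u∈U , u∈S))))

    shrink-independent : ∀ {U : Pred V 0ℓ} {L : Pred C 0ℓ} {f} → Decidable U → Independent U →
                         Many 2 L → Shrink U L f
    shrink-independent {U} {L} {f} U? ind (c , c∈L , d , (d∈L , d≢c) , _) =
      result sw , d , reaches sw , d∈L , λ u∈U eq → d≢c (trans (sym eq) (swept sw u∈U))
      where
      sw : Swept U L U c f
      sw = sweep U? id ind c∈L (λ p q e _ → ind p q e)

-- Losing a colour against at most three columns

module Columns (G : Graph) where

  open Recolouring G

  2K₂-free : Set
  2K₂-free = ∀ {a b c d} → E a b → E c d → ¬ E a c → ¬ E a d → ¬ E b c → ¬ E b d → ⊥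

  Covers : Fin 3 → Fin 3 → Fin 3 → Set
  Covers a b t = ∀ j → j ≡ a ⊎ j ≡ b ⊎ j ≡ t

  record Others (t : Fin 3) : Set where
    constructor columns
    field
      {a b}  : Fin 3
      a≢b    : a ≢ b
      a≢t    : a ≢ t
      b≢t    : b ≢ t
      covers : Covers a b t

  otherColumns : ∀ t → Others t
  otherColumns zero = columns {a = suc zero} {suc (suc zero)} (λ ()) (λ ()) (λ ()) λ
    { zero → inj₂ (inj₂ refl) ; (suc zero) → inj₁ refl ; (suc (suc zero)) → inj₂ (inj₁ refl) }
  otherColumns (suc zero) = columns {a = zero} {suc (suc zero)} (λ ()) (λ ()) (λ ()) λ
    { zero → inj₁ refl ; (suc zero) → inj₂ (inj₂ refl) ; (suc (suc zero)) → inj₂ (inj₁ refl) }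
  otherColumns (suc (suc zero)) = columns {a = zero} {suc zero} (λ ()) (λ ()) (λ ()) λ
    { zero → inj₁ refl ; (suc zero) → inj₂ (inj₁ refl) ; (suc (suc zero)) → inj₂ (inj₂ refl) }

  -- The rows are the classes of the current colouring f, the columns those of a
  -- fixed colouring γ.
  module Moves {U : Pred V 0ℓ} (U? : Decidable U) {γ : V → Fin 3} (γ-proper : ProperOn U γ)
               (no2K₂ : 2K₂-free) where

    module _ {ℓ : ℕ} where

      record Cell (f : V → Fin ℓ) (c : Fin ℓ) (j : Fin 3) (u : V) : Set where
        constructor cell
        field
          inU : U u
          row : f u ≡ c
          col : γ u ≡ j

      open Cell public

      Cell? : ∀ f c j → Decidable (Cell f c j)
      Cell? f c j u with U? u | f u ≟ c | γ u ≟ j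
      ... | yes p | yes q | yes r = yes (cell p q r)
      ... | no ¬p | _     | _     = no (¬p ∘ inU)
      ... | _     | no ¬q | _     = no (¬q ∘ row)
      ... | _     | _     | no ¬r = no (¬r ∘ col)

      Avoids : (V → Fin ℓ) → Fin ℓ → Fin 3 → Set
      Avoids f c j = ∀ {u} → U u → f u ≡ c → γ u ≢ j

      Row : (V → Fin ℓ) → Fin ℓ → Pred V 0ℓ
      Row f c u = U u × f u ≡ c

      Row? : ∀ f c → Decidable (Row f c)
      Row? f c u = U? u ×-dec f u ≟ c

      -- Two edges on opposite diagonals of a 2 × 2 block induce 2K₂, because an end of one and an
      -- end of the other always share a row or a column.
      crossing : ∀ {L f c d a b} → Proper U L f → Linked (Cell f c a) (Cell f d b) →
                 ¬ Linked (Cell f c b) (Cell f d a)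
      crossing (_ , prop) (x , y , cell Ux fx γx , cell Uy fy γy , xy)
                          (z , w , cell Uz fz γz , cell Uw fw γw , zw) =
        no2K₂ xy zw
          (λ e → prop Ux Uz e (trans fx (sym fz)))
          (λ e → γ-proper Ux Uw e (trans γx (sym γw)))
          (λ e → γ-proper Uy Uz e (trans γy (sym γz)))
          (λ e → prop Uy Uw e (trans fy (sym fw)))

      record Vacated (L : Pred (Fin ℓ) 0ℓ) (f : V → Fin ℓ) (c : Fin ℓ) (j : Fin 3)
                     (d : Fin ℓ) : Set where
        field
          result  : V → Fin ℓ
          reaches : Reach U L f result
          still-proper : Proper U L result
          vacant  : Avoids result c j
          still   : ∀ {e t} → (e ≡ d → t ≢ j) → Avoids f e t → Avoids result e t

      -- Only row `d` grows, and only in column `j`; hence the exception in `still`.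
      vacate : ∀ {L f c j d} → Proper U L f → c ≢ d → L d →
               ¬ Linked (Cell f c j) (Row f d) → Vacated L f c j d
      vacate {L} {f} {c} {j} {d} p@(_ , prop) c≢d d∈L unlinked = record
        { result  = g
        ; reaches = reaches sw
        ; still-proper = reach-proper (reaches sw) p
        ; vacant  = vacant
        ; still   = still
        }
        where
        sw : Swept U L (Cell f c j) d f
        sw = sweep (Cell? f c j) inU
               (λ x y e → prop (inU x) (inU y) e (trans (row x) (sym (row y)))) d∈L
               (λ s∈S w∈U e fw≡d → unlinked (_ , _ , s∈S , (w∈U , fw≡d) , e))

        g = result sw

        vacant : Avoids g c j
        vacant {u} u∈U gu≡c γu≡j with f u ≟ c
        ... | yes fu≡c = c≢d (trans (sym gu≡c) (swept sw (cell u∈U fu≡c γu≡j)))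
        ... | no  fu≢c = fu≢c (trans (sym (kept sw (fu≢c ∘ row))) gu≡c)

        still : ∀ {e t} → (e ≡ d → t ≢ j) → Avoids f e t → Avoids g e t
        still {e} {t} ok av {u} u∈U gu≡e γu≡t with Cell? f c j u
        ... | yes x = ok (trans (sym gu≡e) (swept sw x)) (trans (sym γu≡t) (col x))
        ... | no ¬x = av u∈U (trans (sym (kept sw ¬x)) gu≡e) γu≡t

      record Exchanged (L : Pred (Fin ℓ) 0ℓ) (f : V → Fin ℓ) (c d : Fin ℓ) (a b t : Fin 3)
                       : Set where
        field
          result  : V → Fin ℓ
          reaches : Reach U L f result
          still-proper : Proper U L result
          vacant  : Avoids result d a ⊎ Avoids result d b
          still   : ∀ {e u} → (e ≡ c → u ≡ t) → Avoids f e u → Avoids result e u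

      -- Row c meets only the columns a and b, so a cell of row d in one of them moves into
      -- row c once it is unlinked to the cell of row c in the other.
      exchange : ∀ {L f c d a b t} → Proper U L f → c ≢ d → L c →
                 Covers a b t → a ≢ t → b ≢ t → Avoids f c t → Exchanged L f c d a b t
      exchange {L} {f} {c} {d} {a} {b} {t} p c≢d c∈L cov a≢t b≢t av
        with Linked? (Cell? f d a) (Cell? f c b)
      ... | no unlinked = record
        { result = Vacated.result v ; reaches = Vacated.reaches v ; still-proper = Vacated.still-proper v
        ; vacant = inj₁ (Vacated.vacant v)
        ; still  = λ ok → Vacated.still v (λ e≡c u≡a → a≢t (trans (sym u≡a) (ok e≡c))) }
        where
        v : Vacated L f d a c
        v = vacate p (c≢d ∘ sym) c∈L λ where
          (x , y , X , (y∈U , fy≡c) , e) → case cov (γ y) of λ where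
            (inj₁ γy≡a)        → γ-proper (inU X) y∈U e (trans (col X) (sym γy≡a))
            (inj₂ (inj₁ γy≡b)) → unlinked (x , y , X , cell y∈U fy≡c γy≡b , e)
            (inj₂ (inj₂ γy≡t)) → av y∈U fy≡c γy≡t
      ... | yes linked = record
        { result = Vacated.result v ; reaches = Vacated.reaches v ; still-proper = Vacated.still-proper v
        ; vacant = inj₂ (Vacated.vacant v)
        ; still  = λ ok → Vacated.still v (λ e≡c u≡b → b≢t (trans (sym u≡b) (ok e≡c))) }
        where
        v : Vacated L f d b c
        v = vacate p (c≢d ∘ sym) c∈L λ where
          (x , y , X , (y∈U , fy≡c) , e) → case cov (γ y) of λ where
            (inj₁ γy≡a)        → crossing p linked (x , y , X , cell y∈U fy≡c γy≡a , e)
            (inj₂ (inj₁ γy≡b)) → γ-proper (inU X) y∈U e (trans (col X) (sym γy≡b))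
            (inj₂ (inj₂ γy≡t)) → av y∈U fy≡c γy≡t

      shrink-column : ∀ {L f d a b t} → Proper U L f → L d → Covers a b t →
                      Avoids f d a → Avoids f d t →
                      (∀ g → Proper (U ∖ (λ u → γ u ≡ b)) (L ∖ (_≡ d)) g →
                             Shrink (U ∖ (λ u → γ u ≡ b)) (L ∖ (_≡ d)) g) →
                      Shrink U L f
      shrink-column {L} {f} {d} {a} {b} {t} p d∈L cov ava avt =
        shrink-class U? (λ u → γ u ≟ b) p
          (λ u∈U v∈U γu γv e → γ-proper u∈U v∈U e (trans γu (sym γv))) d∈L class
        where
        class : ∀ {u} → U u → f u ≡ d → γ u ≡ b
        class {u} u∈U fu≡d with cov (γ u)
        ... | inj₁ γu≡a        = contradiction γu≡a (ava u∈U fu≡d)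
        ... | inj₂ (inj₁ γu≡b) = γu≡b
        ... | inj₂ (inj₂ γu≡t) = contradiction γu≡t (avt u∈U fu≡d)

      -- After `exchange`, row `d` avoids `t` and one more column, so it lies in the third, which is
      -- set aside with colour `d`. That column is never `t`, whence `j ≢ t` in the continuation.
      shrink-two-rows : ∀ {L f c d a b t} → Proper U L f → c ≢ d → L c → L d →
                        Covers a b t → a ≢ t → b ≢ t → Avoids f c t → Avoids f d t →
                        (∀ {j} → j ≢ t → ∀ g → Proper (U ∖ (λ u → γ u ≡ j)) (L ∖ (_≡ d)) g →
                               Shrink (U ∖ (λ u → γ u ≡ j)) (L ∖ (_≡ d)) g) →
                        Shrink U L f
      shrink-two-rows {f = f} {c} {d} {a} {b} {t} p c≢d c∈L d∈L cov a≢t b≢t avc avd rest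
        with exchange {d = d} p c≢d c∈L cov a≢t b≢t avc
      ... | record { result = g ; reaches = r ; still-proper = q ; vacant = inj₁ ava ; still = still } =
        shrink-reach r (shrink-column q d∈L cov ava
          (still (λ d≡c → contradiction (sym d≡c) c≢d) avd) (rest b≢t))
      ... | record { result = g ; reaches = r ; still-proper = q ; vacant = inj₂ avb ; still = still } =
        shrink-reach r (shrink-column q d∈L cov′ avb
          (still (λ d≡c → contradiction (sym d≡c) c≢d) avd) (rest a≢t))
        where
        cov′ : Covers b a t
        cov′ j = [ inj₂ ∘ inj₁ , [ inj₁ , inj₂ ∘ inj₂ ] ] (cov j)

  module _ (no2K₂ : 2K₂-free) {ℓ : ℕ} where

    shrink-two-columns : ∀ {U : Pred V 0ℓ} {L : Pred (Fin ℓ) 0ℓ} {γ : V → Fin 3} {f t} →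
                         Decidable U → ProperOn U γ → (∀ {u} → U u → γ u ≢ t) →
                         Many 3 L → Proper U L f → Shrink U L f
    shrink-two-columns {U} {L} {γ} {f} {t} U? γ-proper γ≢t
      M@(c , c∈L , d , (d∈L , d≢c) , _) p with otherColumns t
    ... | columns {a} {b} _ a≢t b≢t cov =
      shrink-two-rows p (d≢c ∘ sym) c∈L d∈L cov a≢t b≢t (λ u∈U _ → γ≢t u∈U) (λ u∈U _ → γ≢t u∈U)
        -- Column `t` is empty and column `j` is set aside, so one independent column remains, with
        -- two colours left.
        (λ {j} j≢t g _ → shrink-independent (U? ∖? λ u → γ u ≟ j) (ind j≢t) (many-remove 2 M d))
      where
      open Moves U? γ-proper no2K₂

      same : ∀ {i j k} → i ≢ t → j ≢ t → k ≢ t → i ≢ k → j ≢ k → i ≡ j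
      same {i} {j} {k} it jt kt ik jk with cov i | cov j | cov k
      ... | inj₁ refl | inj₁ refl | _ = refl
      ... | inj₂ (inj₁ refl) | inj₂ (inj₁ refl) | _ = refl
      ... | inj₁ refl | inj₂ (inj₁ refl) | inj₁ refl = contradiction refl ik
      ... | inj₁ refl | inj₂ (inj₁ refl) | inj₂ (inj₁ refl) = contradiction refl jk
      ... | inj₂ (inj₁ refl) | inj₁ refl | inj₁ refl = contradiction refl jk
      ... | inj₂ (inj₁ refl) | inj₁ refl | inj₂ (inj₁ refl) = contradiction refl ik
      ... | inj₂ (inj₂ i≡t) | _ | _ = contradiction i≡t it
      ... | _ | inj₂ (inj₂ j≡t) | _ = contradiction j≡t jt
      ... | _ | _ | inj₂ (inj₂ k≡t) = contradiction k≡t kt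

      ind : ∀ {j} → j ≢ t → Independent (U ∖ (λ u → γ u ≡ j))
      ind j≢t (u∈U , γu≢j) (v∈U , γv≢j) e =
        γ-proper u∈U v∈U e (same (γ≢t u∈U) (γ≢t v∈U) j≢t γu≢j γv≢j)

    module _ {U : Pred V 0ℓ} {L : Pred (Fin ℓ) 0ℓ} {γ : V → Fin 3}
             (U? : Decidable U) (γ-proper : ProperOn U γ) (M : Many 4 L) where

      open Moves U? γ-proper no2K₂

      shrink-same-avoided : ∀ {f c d t} → Proper U L f → c ≢ d → L c → L d →
                            Avoids f c t → Avoids f d t → Shrink U L f
      shrink-same-avoided {d = d} {t} p c≢d c∈L d∈L avc avd with otherColumns t
      ... | columns _ a≢t b≢t cov =
        shrink-two-rows p c≢d c∈L d∈L cov a≢t b≢t avc avd λ {j} _ g →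
          shrink-two-columns (U? ∖? λ u → γ u ≟ j) (λ u v → γ-proper (proj₁ u) (proj₁ v))
            proj₂ (many-remove 3 M d)

      -- If row c avoids column t, the three other rows can be made to avoid one of the two
      -- other columns each, and then two of them avoid the same column.
      shrink-avoided : ∀ {f c t} → Proper U L f → L c → Avoids f c t → Shrink U L f
      shrink-avoided {f} {c} {t} p c∈L av with otherColumns t | many-remove 3 M c
      ... | columns {a} {b} a≢b a≢t b≢t cov
          | d₁ , (L₁ , d₁≢c) , d₂ , ((L₂ , d₂≢c) , d₂≢d₁) , d₃ , (((L₃ , d₃≢c) , d₃≢d₁) , d₃≢d₂) , _ =
        shrink-reach (reaches x₁ ◅◅ reaches x₂ ◅◅ reaches x₃)
          (pigeon (keep (d₁≢c) x₃ (keep d₁≢c x₂ (vacant x₁))) (keep d₂≢c x₃ (vacant x₂)) (vacant x₃))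
        where
        open Exchanged

        x₁ = exchange p (d₁≢c ∘ sym) c∈L cov a≢t b≢t av
        x₂ = exchange {d = d₂} (still-proper x₁) (d₂≢c ∘ sym) c∈L cov a≢t b≢t
               (still x₁ (λ _ → refl) av)
        x₃ = exchange {d = d₃} (still-proper x₂) (d₃≢c ∘ sym) c∈L cov a≢t b≢t
               (still x₂ (λ _ → refl) (still x₁ (λ _ → refl) av))

        keep : ∀ {h d e} → e ≢ c → (x : Exchanged L h c d a b t) →
               Avoids h e a ⊎ Avoids h e b → Avoids (result x) e a ⊎ Avoids (result x) e b
        keep e≢c x (inj₁ y) = inj₁ (still x (λ e≡c → contradiction e≡c e≢c) y)
        keep e≢c x (inj₂ y) = inj₂ (still x (λ e≡c → contradiction e≡c e≢c) y)

        g = result x₃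
        q = still-proper x₃

        pigeon : Avoids g d₁ a ⊎ Avoids g d₁ b → Avoids g d₂ a ⊎ Avoids g d₂ b →
                 Avoids g d₃ a ⊎ Avoids g d₃ b → Shrink U L g
        pigeon (inj₁ x) (inj₁ y) _        = shrink-same-avoided q (d₂≢d₁ ∘ sym) L₁ L₂ x y
        pigeon (inj₂ x) (inj₂ y) _        = shrink-same-avoided q (d₂≢d₁ ∘ sym) L₁ L₂ x y
        pigeon (inj₁ x) _        (inj₁ z) = shrink-same-avoided q (d₃≢d₁ ∘ sym) L₁ L₃ x z
        pigeon (inj₂ x) _        (inj₂ z) = shrink-same-avoided q (d₃≢d₁ ∘ sym) L₁ L₃ x z
        pigeon _        (inj₁ y) (inj₁ z) = shrink-same-avoided q (d₃≢d₂ ∘ sym) L₂ L₃ y z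
        pigeon _        (inj₂ y) (inj₂ z) = shrink-same-avoided q (d₃≢d₂ ∘ sym) L₂ L₃ y z

      module _ {f : V → Fin ℓ} (p : Proper U L f) where

        Link : Fin ℓ → Fin 3 → Fin ℓ → Fin 3 → Set
        Link c i d j = Linked (Cell f c i) (Cell f d j)

        link-sym : ∀ {c i d j} → Link c i d j → Link d j c i
        link-sym (x , y , X , Y , e) = y , x , Y , X , E-sym e

        -- Every cell of row c is linked to the preceding cell, cyclically, of row d.
        Winds : Fin ℓ → Fin ℓ → Set
        Winds c d = Link c zero d (suc (suc zero)) × Link c (suc (suc zero)) d (suc zero) ×
                    Link c (suc zero) d zero

        Unvacatable : Fin ℓ → Fin ℓ → Set
        Unvacatable c d = ∀ j → Linked (Cell f c j) (Row f d)

        elsewhere : ∀ {c d} → Unvacatable c d → ∀ {a b t} → Covers a b t →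
                    ¬ Link c t d a → Link c t d b
        elsewhere un {a} {b} {t} cov ¬l with un t
        ... | x , y , X , (y∈U , fy≡d) , e with cov (γ y)
        ...   | inj₁ γy≡a        = contradiction (x , y , X , cell y∈U fy≡d γy≡a , e) ¬l
        ...   | inj₂ (inj₁ γy≡b) = x , y , X , cell y∈U fy≡d γy≡b , e
        ...   | inj₂ (inj₂ γy≡t) =
          contradiction e (λ e → γ-proper (inU X) y∈U e (trans (col X) (sym γy≡t)))

        covers-swap : ∀ {a b t} → Covers a b t → Covers b a t
        covers-swap cov j = [ inj₂ ∘ inj₁ , [ inj₁ , inj₂ ∘ inj₂ ] ] (cov j)

        covers₀ = Others.covers (otherColumns zero)
        covers₁ = Others.covers (otherColumns (suc zero))
        covers₂ = Others.covers (otherColumns (suc (suc zero)))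

        -- One answer decides all others: a link excludes the crossing one, and an unlinked pair
        -- forces the link to the remaining column. The two answers for column 0 of `c` and column 1
        -- of `d` give the two cyclic directions.
        winds-or : ∀ {c d} → Unvacatable c d → Winds c d ⊎ Winds d c
        winds-or {c} {d} un with Linked? (Cell? f c zero) (Cell? f d (suc zero))
        ... | no no₀₁ = inj₁ (l₀₂ , l₂₁ , l₁₀)
          where
          l₀₂ = elsewhere un covers₀ no₀₁
          l₂₁ = elsewhere un covers₂ (crossing p l₀₂)
          l₁₀ = elsewhere un (covers-swap covers₁) (crossing p l₂₁)
        ... | yes l₀₁ = inj₂ (link-sym l₂₀ , link-sym l₁₂ , link-sym l₀₁)
          where
          l₁₂ = elsewhere un covers₁ (crossing p l₀₁)
          l₂₀ = elsewhere un (covers-swap covers₂) (crossing p l₁₂)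

        -- The edge from column 0 of `c` to column 2 of `d` and the edge from column 1 of `d` to
        -- column 0 of `e` induce 2K₂: their ends share column 0 or row `d`, or an edge between them
        -- would cross another link of the windings.
        no-winding-path : ∀ {c d e} → Winds c d → Winds d e → ⊥
        no-winding-path ((x , y , X , Y , xy) , _ , c₁d₀) (d₀e₂ , _ , (z , w , Z , W , zw)) =
          no2K₂ xy zw
            (λ e → crossing p c₁d₀ (x , z , X , Z , e))
            (λ e → γ-proper (inU X) (inU W) e (trans (col X) (sym (col W))))
            (λ e → separated p (inU Y) (inU Z) e (trans (row Y) (sym (row Z))))
            (λ e → crossing p d₀e₂ (y , w , Y , W , e))

        -- Windings orient the three pairs of rows, and every orientation of a triangle has a
        -- directed path with two arcs.
        no-winding : ∀ {c d e} → Unvacatable c d → Unvacatable d e → Unvacatable c e → ⊥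
        no-winding cd de ce with winds-or cd | winds-or de | winds-or ce
        ... | inj₁ x | inj₁ y | _      = no-winding-path x y
        ... | inj₂ x | inj₂ y | _      = no-winding-path y x
        ... | inj₁ x | inj₂ y | inj₁ z = no-winding-path z y
        ... | inj₁ x | inj₂ y | inj₂ z = no-winding-path z x
        ... | inj₂ x | inj₁ y | inj₁ z = no-winding-path x z
        ... | inj₂ x | inj₁ y | inj₂ z = no-winding-path y z

        vacate-or : ∀ {c d} → c ≢ d → L c → L d → Shrink U L f ⊎ Unvacatable c d
        vacate-or {c} {d} c≢d c∈L d∈L with all? (λ j → Linked? (Cell? f c j) (Row? f d))
        ... | yes un = inj₂ un
        ... | no ¬un =
          let j , unlinked = ¬∀⟶∃¬ 3 _ (λ j → Linked? (Cell? f c j) (Row? f d)) ¬un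
              v = vacate p c≢d d∈L unlinked
          in  inj₁ (shrink-reach (Vacated.reaches v)
                     (shrink-avoided (Vacated.still-proper v) c∈L (Vacated.vacant v)))

        shrink-three-columns : Shrink U L f
        shrink-three-columns with many-≤ ℕ.≤-refl M
        ... | c , Lc , d , (Ld , d≢c) , e , ((Le , e≢c) , e≢d) , _
          with vacate-or (d≢c ∘ sym) Lc Ld | vacate-or (e≢d ∘ sym) Ld Le | vacate-or (e≢c ∘ sym) Lc Le
        ... | inj₁ s | _      | _      = s
        ... | _      | inj₁ s | _      = s
        ... | _      | _      | inj₁ s = s
        ... | inj₂ x | inj₂ y | inj₂ z = ⊥-elim (no-winding x y z)

-- Extending a 3-colouring by a vertex, or finding the complement of C₇

module ThreeColouring (G : Graph) where

  open Recolouring G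
  open Columns G

  K₄-free : Set
  K₄-free = ∀ {a b c d} → E a b → E a c → E a d → E b c → E b d → E c d → ⊥

  C₅-free : Set
  C₅-free = ∀ {a b c d e} → E a b → E b c → E c d → E d e → E e a →
            ¬ E a c → ¬ E a d → ¬ E b d → ¬ E b e → ¬ E c e → ⊥

  -- The complement of a 7-cycle c₀ c₁ … c₆.
  record Antihole (W : Pred V 0ℓ) : Set where
    field
      {c₀ c₁ c₂ c₃ c₄ c₅ c₆} : V
      c₀∈ : W c₀
      c₁∈ : W c₁
      c₂∈ : W c₂
      c₃∈ : W c₃
      c₄∈ : W c₄
      c₅∈ : W c₅
      c₆∈ : W c₆
      ¬e₀₁ : ¬ E c₀ c₁
      ¬e₁₂ : ¬ E c₁ c₂
      ¬e₂₃ : ¬ E c₂ c₃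
      ¬e₃₄ : ¬ E c₃ c₄
      ¬e₄₅ : ¬ E c₄ c₅
      ¬e₅₆ : ¬ E c₅ c₆
      ¬e₀₆ : ¬ E c₀ c₆
      e₀₂ : E c₀ c₂
      e₀₃ : E c₀ c₃
      e₀₄ : E c₀ c₄
      e₀₅ : E c₀ c₅
      e₁₃ : E c₁ c₃
      e₁₄ : E c₁ c₄
      e₁₅ : E c₁ c₅
      e₁₆ : E c₁ c₆
      e₂₄ : E c₂ c₄
      e₂₅ : E c₂ c₅
      e₂₆ : E c₂ c₆
      e₃₅ : E c₃ c₅
      e₃₆ : E c₃ c₆
      e₄₆ : E c₄ c₆

  module _ (no2K₂ : 2K₂-free) (noK₄ : K₄-free) (noC₅ : C₅-free) where

    -- The two hypotheses read in the complement, as the absence of holes a b c d (e).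
    coC₄ : ∀ {a b c d} → ¬ E a b → ¬ E b c → ¬ E c d → ¬ E d a → E a c → E b d → ⊥
    coC₄ ab bc cd da ac bd = no2K₂ ac bd ab (da ∘ E-sym) (bc ∘ E-sym) cd

    coC₅ : ∀ {a b c d e} → ¬ E a b → ¬ E b c → ¬ E c d → ¬ E d e → ¬ E e a →
           E a c → E a d → E b d → E b e → E c e → ⊥
    coC₅ ab bc cd de ea ac ad bd be ce =
      noC₅ ac ce (E-sym be) bd (E-sym ad) (ea ∘ E-sym) ab (bc ∘ E-sym) cd (de ∘ E-sym)

    -- Otherwise `v n m m′ n′` is a cycle of the complement whose only possible chords there are
    -- `n m′` and `n′ m`: a chord leaves a hole of length four, and no chord one of length five.
    linked-far : ∀ {v n m n′ m′} → ¬ E n m → ¬ E n′ m′ → ¬ E v n → ¬ E v n′ →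
                 E v m → E v m′ → E n n′ → E m m′
    linked-far {v} {n} {m} {n′} {m′} nm nm′ vn vn′ vm vm′ nn′ with E? m m′ | E? n m′ | E? n′ m
    ... | yes e | _ | _ = e
    ... | no ¬e | no ¬f | _ =
      ⊥-elim (coC₄ vn ¬f (nm′ ∘ E-sym) (vn′ ∘ E-sym) vm′ nn′)
    ... | no ¬e | _ | no ¬g =
      ⊥-elim (coC₄ vn′ ¬g (nm ∘ E-sym) (vn ∘ E-sym) vm (E-sym nn′))
    ... | no ¬e | yes f | yes g =
      ⊥-elim (coC₅ vn nm ¬e (nm′ ∘ E-sym) (vn′ ∘ E-sym) vm vm′ f nn′ (E-sym g))

    record Bipartition (W : Pred V 0ℓ) : Set₁ where
      field
        Side   : Pred V 0ℓ
        Side?  : Decidable Side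
        inside : Independent (λ u → W u × Side u)
        beyond : Independent (W ∖ Side)

    open Bipartition

    flip : ∀ {W} → Bipartition W → Bipartition W
    flip b = record
      { Side   = ¬_ ∘ Side b
      ; Side?  = ¬? ∘ Side? b
      ; inside = beyond b
      ; beyond = independent-⊆ (λ {u} (w , ¬¬s) → w , decidable-stable (Side? b u) ¬¬s) (inside b)
      }

    insert-left : ∀ {W x} (b : Bipartition W) →
                  (∀ {u} → W u × Side b u → ¬ E x u) → Bipartition (λ u → u ≡ x ⊎ W u)
    insert-left {W} {x} b far = record
      { Side   = λ u → u ≡ x ⊎ Side b u
      ; Side?  = λ u → u ≟ x ⊎-dec Side? b u
      ; inside = independent-⊆
          (λ { (inj₁ u≡x , _) → inj₁ u≡x
             ; (inj₂ _ , inj₁ u≡x) → inj₁ u≡x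
             ; (inj₂ w , inj₂ s) → inj₂ (w , s) })
          (independent-insert (inside b) far)
      ; beyond = independent-⊆
          (λ { (inj₁ u≡x , ¬s) → contradiction (inj₁ u≡x) ¬s ; (inj₂ w , ¬s) → w , ¬s ∘ inj₂ })
          (beyond b)
      }

    -- An induced odd cycle among the neighbours of `r` would be a triangle, completing a K₄, or a
    -- C₅, or long enough to contain 2K₂. Inserting the vertices one at a time avoids extracting
    -- such cycles.
    neighbourhood-bipartite : ∀ r → Bipartition (E r)
    neighbourhood-bipartite r = restrict (λ e → e , ∈-allFin _) (build (allFin order))
      where
      restrict : ∀ {W W′} → W ⊆ W′ → Bipartition W′ → Bipartition W
      restrict W⊆ b = record
        { Side = Side b ; Side? = Side? b
        ; inside = independent-⊆ (λ (w , s) → W⊆ w , s) (inside b)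
        ; beyond = independent-⊆ (λ (w , s) → W⊆ w , s) (beyond b) }

      -- A new vertex x with neighbours m and m′ on both sides: no two of the neighbours of
      -- x are adjacent, by K₄-freeness, nor are two non-neighbours, since those would
      -- make m and m′ adjacent.
      add : ∀ {W x} → Decidable W → (∀ {u} → W u → E r u) → E r x → Bipartition W →
            Bipartition (λ u → u ≡ x ⊎ W u)
      add {W} {x} W? W⊆r rx b
        with any? (λ u → (W? u ×-dec Side? b u) ×-dec E? x u)
           | any? (λ u → (W? u ×-dec ¬? (Side? b u)) ×-dec E? x u)
      ... | no none | _ = insert-left b (λ s e → none (_ , s , e))
      ... | yes _ | no none = insert-left (flip b) (λ s e → none (_ , s , e))
      ... | yes (m , (m∈W , s) , xm) | yes (m′ , (m′∈W , ¬s′) , xm′) = record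
        { Side   = ¬_ ∘ E x
        ; Side?  = ¬? ∘ E? x
        ; inside = independent-⊆
            (λ { (inj₁ u≡x , _) → inj₁ u≡x ; (inj₂ w , ¬xu) → inj₂ (w , ¬xu) })
            (independent-insert far proj₂)
        ; beyond = λ (u∈ , ¬¬xu) (w∈ , ¬¬xw) uw →
            ¬¬xu λ xu → ¬¬xw λ xw → noK₄ rx (near u∈) (near w∈) xu xw uw
        }
        where
        near : ∀ {u} → u ≡ x ⊎ W u → E r u
        near (inj₁ refl) = rx
        near (inj₂ w)    = W⊆r w

        across : ∀ {u w} → W u × Side b u → (W ∖ Side b) w → ¬ E x u → ¬ E x w → ¬ E u w
        across su sw ¬xu ¬xw uw = noK₄ rx (W⊆r m∈W) (W⊆r m′∈W) xm xm′
          (linked-far (inside b su (m∈W , s)) (beyond b sw (m′∈W , ¬s′)) ¬xu ¬xw xm xm′ uw)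

        far : Independent (λ u → W u × ¬ E x u)
        far {u} {w} (u∈W , ¬xu) (w∈W , ¬xw) uw with Side? b u | Side? b w
        ... | yes su | yes sw = inside b (u∈W , su) (w∈W , sw) uw
        ... | no ¬su | no ¬sw = beyond b (u∈W , ¬su) (w∈W , ¬sw) uw
        ... | yes su | no ¬sw = across (u∈W , su) (w∈W , ¬sw) ¬xu ¬xw uw
        ... | no ¬su | yes sw = across (w∈W , sw) (u∈W , ¬su) ¬xw ¬xu (E-sym uw)

      build : ∀ xs → Bipartition (λ u → E r u × u ∈ xs)
      build [] = record
        { Side = λ _ → ⊤ ; Side? = λ _ → yes tt
        ; inside = λ { ((_ , ()) , _) } ; beyond = λ { ((_ , ()) , _) } }
      build (x ∷ xs) with E? r x
      ... | yes rx = restrict (λ { (_ , here u≡x) → inj₁ u≡x ; (e , there i) → inj₂ (e , i) })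
                       (add (λ u → E? r u ×-dec u ∈? xs) proj₁ rx (build xs))
      ... | no ¬rx = restrict (λ { (e , here refl) → contradiction e ¬rx ; (e , there i) → e , i })
                       (build xs)

    module Insert {W : Pred V 0ℓ} (W? : Decidable W) {f : V → Fin 3} (f-proper : ProperOn W f)
                  (v : V) where

      W⁺ : Pred V 0ℓ
      W⁺ u = u ≡ v ⊎ W u

      Colourable : Set
      Colourable = ∃ λ (g : V → Fin 3) → ProperOn W⁺ g

      -- The common form of all new colourings: `v` joins `R`, then comes `Q`, and what remains is
      -- the third class.
      colour-classes : ∀ {R Q : Pred V 0ℓ} → Decidable R → Decidable Q →
                       Independent (λ u → W u × R u) → (∀ {u} → W u × R u → ¬ E v u) →
                       Independent (λ u → (W ∖ R) u × Q u) → Independent ((W ∖ R) ∖ Q) →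
                       Colourable
      colour-classes {R} {Q} R? Q? indR far indQ indRest = g , g-proper
        where
        g : V → Fin 3
        g u with u ≟ v ⊎-dec R? u | Q? u
        ... | yes _ | _     = zero
        ... | no _  | yes _ = suc zero
        ... | no _  | no _  = suc (suc zero)

        inW : ∀ {u} → W⁺ u → ¬ (u ≡ v ⊎ R u) → (W ∖ R) u
        inW (inj₁ u≡v) ¬r = contradiction (inj₁ u≡v) ¬r
        inW (inj₂ w)   ¬r = w , ¬r ∘ inj₂

        inR : ∀ {u} → W⁺ u → u ≡ v ⊎ R u → u ≡ v ⊎ W u × R u
        inR _        (inj₁ u≡v) = inj₁ u≡v
        inR (inj₁ u≡v) _        = inj₁ u≡v
        inR (inj₂ w) (inj₂ r)   = inj₂ (w , r)

        g-proper : ProperOn W⁺ g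
        g-proper {u} {w} u∈ w∈ e with u ≟ v ⊎-dec R? u | w ≟ v ⊎-dec R? w | Q? u | Q? w
        ... | yes r | yes r′ | _ | _ = λ _ → independent-insert indR far (inR u∈ r) (inR w∈ r′) e
        ... | yes _ | no _ | _ | yes _ = λ ()
        ... | yes _ | no _ | _ | no _ = λ ()
        ... | no _ | yes _ | yes _ | _ = λ ()
        ... | no _ | yes _ | no _ | _ = λ ()
        ... | no ¬r | no ¬r′ | yes q | yes q′ = λ _ → indQ (inW u∈ ¬r , q) (inW w∈ ¬r′ , q′) e
        ... | no _ | no _ | yes _ | no _ = λ ()
        ... | no _ | no _ | no _ | yes _ = λ ()
        ... | no ¬r | no ¬r′ | no ¬q | no ¬q′ =
          λ _ → indRest (inW u∈ ¬r , ¬q) (inW w∈ ¬r′ , ¬q′) e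

      column-independent : ∀ {S : Pred V 0ℓ} {j} → S ⊆ W → (∀ {u} → S u → f u ≡ j) → Independent S
      column-independent S⊆W fS s s′ e = f-proper (S⊆W s) (S⊆W s′) e (trans (fS s) (sym (fS s′)))

      record N (j : Fin 3) (u : V) : Set where
        constructor mkN
        field
          inW    : W u
          ¬vu    : ¬ E v u
          colour : f u ≡ j

      record M (j : Fin 3) (u : V) : Set where
        constructor mkM
        field
          inW    : W u
          vu     : E v u
          colour : f u ≡ j

      N? : ∀ j → Decidable (N j)
      N? j u with W? u | E? v u | f u ≟ j
      ... | yes p | no ¬q | yes r = yes (mkN p ¬q r)
      ... | no ¬p | _     | _     = no (¬p ∘ N.inW)
      ... | _     | yes q | _     = no (λ x → N.¬vu x q)
      ... | _     | _     | no ¬r = no (¬r ∘ N.colour)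

      M? : ∀ j → Decidable (M j)
      M? j u with W? u | E? v u | f u ≟ j
      ... | yes p | yes q | yes r = yes (mkM p q r)
      ... | no ¬p | _     | _     = no (¬p ∘ M.inW)
      ... | _     | no ¬q | _     = no (¬q ∘ M.vu)
      ... | _     | _     | no ¬r = no (¬r ∘ M.colour)

      NN : ∀ {j u w} → N j u → N j w → ¬ E u w
      NN x y e = f-proper (N.inW x) (N.inW y) e (trans (N.colour x) (sym (N.colour y)))

      NM : ∀ {j u w} → N j u → M j w → ¬ E u w
      NM x y e = f-proper (N.inW x) (M.inW y) e (trans (N.colour x) (sym (M.colour y)))

      MM : ∀ {j u w} → M j u → M j w → ¬ E u w
      MM x y e = f-proper (M.inW x) (M.inW y) e (trans (M.colour x) (sym (M.colour y)))

      Joined : Fin 3 → Fin 3 → Set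
      Joined i j = Linked (N i) (N j)

      joined-sym : ∀ {i j} → Joined i j → Joined j i
      joined-sym (x , y , X , Y , e) = y , x , Y , X , E-sym e

      joined-M : ∀ {i j} → Joined i j → ∀ {m m′} → M i m → M j m′ → E m m′
      joined-M (x , y , X , Y , e) m m′ =
        linked-far (NM X m) (NM Y m′) (N.¬vu X) (N.¬vu Y) (M.vu m) (M.vu m′) e

      Tied : Fin 3 → Pred V 0ℓ
      Tied j u = ∃ λ y → N j y × E u y

      Tied? : ∀ j → Decidable (Tied j)
      Tied? j u = any? λ y → N? j y ×-dec E? u y

      Near : Fin 3 → Pred V 0ℓ
      Near j u = ∃ λ y → M j y × E u y

      Near? : ∀ j → Decidable (Near j)
      Near? j u = any? λ y → M? j y ×-dec E? u y

      cross : ∀ {a b t u w} → Covers a b t → W u → W w → E u w → f u ≢ t → f w ≢ t →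
              (f u ≡ a × f w ≡ b) ⊎ (f u ≡ b × f w ≡ a)
      cross {u = u} {w} cov u∈W w∈W e u≢t w≢t with cov (f u) | cov (f w)
      ... | inj₁ p        | inj₂ (inj₁ q) = inj₁ (p , q)
      ... | inj₂ (inj₁ p) | inj₁ q        = inj₂ (p , q)
      ... | inj₁ p        | inj₁ q        = contradiction (trans p (sym q)) (f-proper u∈W w∈W e)
      ... | inj₂ (inj₁ p) | inj₂ (inj₁ q) = contradiction (trans p (sym q)) (f-proper u∈W w∈W e)
      ... | inj₂ (inj₂ p) | _             = contradiction p u≢t
      ... | _             | inj₂ (inj₂ q) = contradiction q w≢t

      free-column : ∀ j → (∀ {u} → W u → f u ≡ j → ¬ E v u) → Colourable
      free-column j far with otherColumns j
      ... | columns {a} {b} _ _ _ cov =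
        colour-classes (λ u → f u ≟ j) (λ u → f u ≟ a)
          (column-independent proj₁ proj₂) (λ (w , c) → far w c)
          (column-independent (proj₁ ∘ proj₁) proj₂)
          (column-independent (proj₁ ∘ proj₁) rest)
        where
        rest : ∀ {u} → ((W ∖ (λ u → f u ≡ j)) ∖ (λ u → f u ≡ a)) u → f u ≡ b
        rest {u} ((_ , ≢j) , ≢a) with cov (f u)
        ... | inj₁ p        = contradiction p ≢a
        ... | inj₂ (inj₁ p) = p
        ... | inj₂ (inj₂ p) = contradiction p ≢j

      -- The non-neighbours of `v` are independent and share its colour; the neighbours need two
      -- more.
      no-links : (∀ i j → ¬ Joined i j) → Colourable
      no-links none = colour-classes (λ u → ¬? (E? v u)) (Side? b)
        (λ (u∈W , ¬vu) (w∈W , ¬vw) e → none _ _ (_ , _ , mkN u∈W ¬vu refl , mkN w∈W ¬vw refl , e))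
        proj₂
        (independent-⊆ (λ ((_ , ¬¬vu) , s) → decidable-stable (E? v _) ¬¬vu , s) (inside b))
        (independent-⊆ (λ ((_ , ¬¬vu) , s) → decidable-stable (E? v _) ¬¬vu , s) (beyond b))
        where
        b = neighbourhood-bipartite v

      -- M t is complete to M a and to M b, so M a ∪ M b is independent by K₄-freeness.
      two-links : ∀ {a b t} → Covers a b t → ¬ Joined a b → Joined a t → Joined b t → ∃ (M t) → Colourable
      two-links {a} {b} {t} cov ¬ab at bt (m , m∈M) =
        colour-classes (λ u → ¬? (E? v u) ×-dec ¬? (f u ≟ t)) (λ u → f u ≟ t)
          indR (λ (_ , ¬vu , _) → ¬vu) (column-independent (proj₁ ∘ proj₁) proj₂) indRest
        where
        indR : Independent (λ u → W u × (¬ E v u × f u ≢ t))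
        indR (u∈W , ¬vu , u≢t) (w∈W , ¬vw , w≢t) e with cross cov u∈W w∈W e u≢t w≢t
        ... | inj₁ (p , q) = ¬ab (_ , _ , mkN u∈W ¬vu p , mkN w∈W ¬vw q , e)
        ... | inj₂ (p , q) = ¬ab (_ , _ , mkN w∈W ¬vw q , mkN u∈W ¬vu p , E-sym e)

        clash : ∀ {u w} → M a u → M b w → ¬ E u w
        clash x y e =
          noK₄ (M.vu x) (M.vu y) (M.vu m∈M) e (joined-M at x m∈M) (joined-M bt y m∈M)

        indRest : Independent ((W ∖ (λ u → ¬ E v u × f u ≢ t)) ∖ (λ u → f u ≡ t))
        indRest {u} {w} ((u∈W , ¬r) , u≢t) ((w∈W , ¬r′) , w≢t) e
          with cross cov u∈W w∈W e u≢t w≢t | E? v u | E? v w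
        ... | _ | no ¬vu | _ = ¬r (¬vu , u≢t)
        ... | _ | _ | no ¬vw = ¬r′ (¬vw , w≢t)
        ... | inj₁ (p , q) | yes vu | yes vw = clash (mkM u∈W vu p) (mkM w∈W vw q) e
        ... | inj₂ (p , q) | yes vu | yes vw = clash (mkM w∈W vw q) (mkM u∈W vu p) (E-sym e)

      -- The colour classes are v with its non-neighbours, except those of colour a tied to
      -- colour b; then the rest of colour a with the vertices of colour t near colour b; then
      -- what remains.
      one-link : ∀ {a b t} → a ≢ b → a ≢ t → b ≢ t → Covers a b t → Joined a b → ¬ Joined a t → ¬ Joined b t →
                 ¬ Linked (λ u → N a u × Tied b u) (λ u → M t u × Near b u) → Colourable
      one-link {a} {b} {t} a≢b a≢t b≢t cov ab ¬at ¬bt unlinked =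
        colour-classes R? Q? indR (λ (_ , ¬vu , _) → ¬vu) indQ indRest
        where
        R Q : Pred V 0ℓ
        R u = ¬ E v u × (f u ≢ a ⊎ ¬ Tied b u)
        Q u = f u ≡ a ⊎ f u ≡ t × Near b u

        R? : Decidable R
        R? u = ¬? (E? v u) ×-dec (¬? (f u ≟ a) ⊎-dec ¬? (Tied? b u))

        Q? : Decidable Q
        Q? u = f u ≟ a ⊎-dec f u ≟ t ×-dec Near? b u

        ordered : ∀ {S : Pred V 0ℓ} → S ⊆ W →
                  (∀ {u w} → S u → S w → f u ≡ a → f w ≡ b → ¬ E u w) →
                  (∀ {u w} → S u → S w → f u ≡ a → f w ≡ t → ¬ E u w) →
                  (∀ {u w} → S u → S w → f u ≡ b → f w ≡ t → ¬ E u w) → Independent S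
        ordered S⊆W ab at bt {u} {w} s s′ e with cov (f u) | cov (f w)
        ... | inj₁ p | inj₁ q = f-proper (S⊆W s) (S⊆W s′) e (trans p (sym q))
        ... | inj₂ (inj₁ p) | inj₂ (inj₁ q) = f-proper (S⊆W s) (S⊆W s′) e (trans p (sym q))
        ... | inj₂ (inj₂ p) | inj₂ (inj₂ q) = f-proper (S⊆W s) (S⊆W s′) e (trans p (sym q))
        ... | inj₁ p | inj₂ (inj₁ q) = ab s s′ p q e
        ... | inj₁ p | inj₂ (inj₂ q) = at s s′ p q e
        ... | inj₂ (inj₁ p) | inj₂ (inj₂ q) = bt s s′ p q e
        ... | inj₂ (inj₁ p) | inj₁ q = ab s′ s q p (E-sym e)
        ... | inj₂ (inj₂ p) | inj₁ q = at s′ s q p (E-sym e)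
        ... | inj₂ (inj₂ p) | inj₂ (inj₁ q) = bt s′ s q p (E-sym e)

        indR : Independent (λ u → W u × R u)
        indR = ordered proj₁
          (λ { (_ , _ , inj₁ u≢a) _ p _ _ → u≢a p
             ; (_ , _ , inj₂ ¬tied) (w∈W , ¬vw , _) _ q e → ¬tied (_ , mkN w∈W ¬vw q , e) })
          (λ (u∈W , ¬vu , _) (w∈W , ¬vw , _) p q e → ¬at (_ , _ , mkN u∈W ¬vu p , mkN w∈W ¬vw q , e))
          (λ (u∈W , ¬vu , _) (w∈W , ¬vw , _) p q e → ¬bt (_ , _ , mkN u∈W ¬vu p , mkN w∈W ¬vw q , e))

        neighbour : ∀ {u} → ¬ R u → f u ≢ a → E v u
        neighbour {u} ¬r u≢a = decidable-stable (E? v u) (λ ¬vu → ¬r (¬vu , inj₁ u≢a))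

        notb : ∀ {u} → Q u → f u ≢ b
        notb (inj₁ p)       q = a≢b (trans (sym p) q)
        notb (inj₂ (p , _)) q = b≢t (trans (sym q) p)

        -- If `u` is a neighbour of `v`, it is adjacent to the vertex `y` that makes `w` near `b`,
        -- as `M a` is complete to `M b`, and `v u w y` is a K₄. Otherwise `u` is tied to `b`, and
        -- `unlinked` applies.
        at′ : ∀ {u w} → (W ∖ R) u × Q u → (W ∖ R) w × Q w → f u ≡ a → f w ≡ t → ¬ E u w
        at′ _ (_ , inj₁ q′) _ q e = a≢t (trans (sym q′) q)
        at′ {u} {w} ((u∈W , ¬r) , _) ((w∈W , ¬r′) , inj₂ (_ , near@(y , y∈M , wy))) p q e
          with E? v u
        ... | yes vu = let u∈M = mkM u∈W vu p in
          noK₄ vu (neighbour ¬r′ (λ q′ → a≢t (trans (sym q′) q))) (M.vu y∈M) e (joined-M ab u∈M y∈M) wy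
        ... | no ¬vu = unlinked (u , w ,
          (mkN u∈W ¬vu p , decidable-stable (Tied? b u) (λ ¬t → ¬r (¬vu , inj₂ ¬t))) ,
          (mkM w∈W (neighbour ¬r′ (λ q′ → a≢t (trans (sym q′) q))) q , near) , e)

        indQ : Independent (λ u → (W ∖ R) u × Q u)
        indQ = ordered (proj₁ ∘ proj₁)
          (λ _ (_ , q) _ r _ → notb q r) at′ (λ (_ , q) _ r _ _ → notb q r)

        indRest : Independent ((W ∖ R) ∖ Q)
        indRest = ordered (proj₁ ∘ proj₁)
          (λ (_ , ¬q) _ p _ _ → ¬q (inj₁ p)) (λ (_ , ¬q) _ p _ _ → ¬q (inj₁ p))
          (λ ((u∈W , ¬r) , _) (_ , ¬q) p q e →
            ¬q (inj₂ (q , _ , mkM u∈W (neighbour ¬r (λ p′ → a≢b (trans (sym p′) p))) p , E-sym e)))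

      -- The antihole is v x m₁ e₁ e₂ m₂ y for a suitable edge xy between N a and N b.
      crossed-links : ∀ {a b t} → Joined a b →
                      Linked (λ u → N a u × Tied b u) (λ u → M t u × Near b u) →
                      Linked (λ u → N b u × Tied a u) (λ u → M t u × Near a u) → Antihole W⁺
      crossed-links {a} {b} {t} ab
        (n₁ , e₁ , (N₁ , n₂* , N₂* , n₁n₂*) , (E₁ , m₂ , M₂ , e₁m₂) , n₁e₁)
        (n₂ , e₂ , (N₂ , n₁* , N₁* , n₂n₁*) , (E₂ , m₁ , M₁ , e₂m₁) , n₂e₂) = antihole
        where
        m₁m₂ = joined-M ab M₁ M₂

        m₁e₁ : ¬ E m₁ e₁
        m₁e₁ e = noK₄ (M.vu M₁) (M.vu M₂) (M.vu E₁) m₁m₂ e (E-sym e₁m₂)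

        e₂m₂ : ¬ E e₂ m₂
        e₂m₂ e = noK₄ (M.vu M₁) (M.vu M₂) (M.vu E₂) m₁m₂ (E-sym e₂m₁) (E-sym e)

        from-pair : ∀ {x y} → N a x → N b y → E x y → E x e₁ → E y e₂ → Antihole W⁺
        from-pair {x} {y} X Y xy xe₁ ye₂ = record
          { c₀ = v ; c₁ = x ; c₂ = m₁ ; c₃ = e₁ ; c₄ = e₂ ; c₅ = m₂ ; c₆ = y
          ; c₀∈ = inj₁ refl ; c₁∈ = inj₂ (N.inW X) ; c₂∈ = inj₂ (M.inW M₁) ; c₃∈ = inj₂ (M.inW E₁)
          ; c₄∈ = inj₂ (M.inW E₂) ; c₅∈ = inj₂ (M.inW M₂) ; c₆∈ = inj₂ (N.inW Y)
          ; ¬e₀₁ = N.¬vu X ; ¬e₁₂ = NM X M₁ ; ¬e₂₃ = m₁e₁ ; ¬e₃₄ = MM E₁ E₂ ; ¬e₄₅ = e₂m₂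
          ; ¬e₅₆ = NM Y M₂ ∘ E-sym ; ¬e₀₆ = N.¬vu Y
          ; e₀₂ = M.vu M₁ ; e₀₃ = M.vu E₁ ; e₀₄ = M.vu E₂ ; e₀₅ = M.vu M₂
          ; e₁₃ = xe₁ ; e₁₄ = xe₂ ; e₁₅ = xm₂ ; e₁₆ = xy
          ; e₂₄ = E-sym e₂m₁ ; e₂₅ = m₁m₂ ; e₂₆ = E-sym ym₁
          ; e₃₅ = e₁m₂ ; e₃₆ = E-sym ye₁ ; e₄₆ = E-sym ye₂ }
          where
          xm₂ : E x m₂
          xm₂ = decidable-stable (E? x m₂) λ ¬e →
            coC₄ (N.¬vu X) ¬e (NM Y M₂ ∘ E-sym) (N.¬vu Y ∘ E-sym) (M.vu M₂) xy

          ym₁ : E y m₁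
          ym₁ = decidable-stable (E? y m₁) λ ¬e →
            coC₄ (N.¬vu Y) ¬e (NM X M₁ ∘ E-sym) (N.¬vu X ∘ E-sym) (M.vu M₁) (E-sym xy)

          xe₂ : E x e₂
          xe₂ = decidable-stable (E? x e₂) λ ¬e →
            coC₅ (N.¬vu X) ¬e e₂m₂ (NM Y M₂ ∘ E-sym) (N.¬vu Y ∘ E-sym)
              (M.vu E₂) (M.vu M₂) xm₂ xy (E-sym ye₂)

          ye₁ : E y e₁
          ye₁ = decidable-stable (E? y e₁) λ ¬e →
            coC₅ (N.¬vu Y) ¬e (m₁e₁ ∘ E-sym) (NM X M₁ ∘ E-sym) (N.¬vu X ∘ E-sym)
              (M.vu E₁) (M.vu M₁) ym₁ (E-sym xy) (E-sym xe₁)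

        -- If `n₁*` and `n₂*` are not adjacent, `n₁ n₁* n₂* n₂` is a hole of the complement; if they
        -- are, `v n₁* e₁ e₂ n₂*` is one.
        impossible : ¬ E n₁ n₂ → ¬ E n₂* e₂ → ¬ E n₁* e₁ → ⊥
        impossible ¬n₁n₂ ¬n₂*e₂ ¬n₁*e₁ with E? n₁* n₂*
        ... | no ¬n* = coC₄ (NN N₁ N₁*) ¬n* (NN N₂* N₂) (¬n₁n₂ ∘ E-sym) n₁n₂* (E-sym n₂n₁*)
        ... | yes n* = coC₅ (N.¬vu N₁*) ¬n₁*e₁ (MM E₁ E₂) (¬n₂*e₂ ∘ E-sym) (N.¬vu N₂* ∘ E-sym)
                         (M.vu E₁) (M.vu E₂) n₁*e₂ n* (E-sym n₂*e₁)
          where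
          n₁*e₂ : E n₁* e₂
          n₁*e₂ = decidable-stable (E? n₁* e₂) λ ¬e →
            coC₄ (N.¬vu N₁*) ¬e (¬n₂*e₂ ∘ E-sym) (N.¬vu N₂* ∘ E-sym) (M.vu E₂) n*

          n₂*e₁ : E n₂* e₁
          n₂*e₁ = decidable-stable (E? n₂* e₁) λ ¬e →
            coC₄ (N.¬vu N₂*) ¬e (¬n₁*e₁ ∘ E-sym) (N.¬vu N₁* ∘ E-sym) (M.vu E₁) (E-sym n*)

        antihole : Antihole W⁺
        antihole with E? n₁ n₂ | E? n₂* e₂ | E? n₁* e₁
        ... | yes n | _ | _ = from-pair N₁ N₂ n n₁e₁ n₂e₂
        ... | no _ | yes e | _ = from-pair N₁ N₂* n₁n₂* n₁e₁ e
        ... | no _ | no _ | yes e = from-pair N₁* N₂ (E-sym n₂n₁*) e n₂e₂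
        ... | no ¬n | no ¬e | no ¬e′ = ⊥-elim (impossible ¬n ¬e ¬e′)

      -- The colouring in `one-link` distinguishes `a` from `b`; if both assignments of these roles
      -- are obstructed, the two obstructions together yield the antihole.
      single-link : ∀ {t} (o : Others t) → let open Others o in
                    Joined a b → ¬ Joined a t → ¬ Joined b t → Colourable ⊎ Antihole W⁺
      single-link {t} (columns {a} {b} a≢b a≢t b≢t cov) ab ¬at ¬bt
        with Linked? (λ u → N? a u ×-dec Tied? b u) (λ u → M? t u ×-dec Near? b u)
           | Linked? (λ u → N? b u ×-dec Tied? a u) (λ u → M? t u ×-dec Near? a u)
      ... | no ¬l | _ = inj₁ (one-link a≢b a≢t b≢t cov ab ¬at ¬bt ¬l)
      ... | _ | no ¬l = inj₁ (one-link (a≢b ∘ sym) b≢t a≢t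
              (λ j → [ inj₂ ∘ inj₁ , [ inj₁ , inj₂ ∘ inj₂ ] ] (cov j)) (joined-sym ab) ¬bt ¬at ¬l)
      ... | yes l | yes l′ = inj₂ (crossed-links ab l l′)

      -- When `v` has neighbours of all three colours, the number of joined pairs decides: three
      -- would give a K₄, two or none give a colouring, and only a single one leaves room for an
      -- antihole.
      insert : Colourable ⊎ Antihole W⁺
      insert with any? (M? zero) | any? (M? (suc zero)) | any? (M? (suc (suc zero)))
      ... | no none | _ | _ =
        inj₁ (free-column _ (λ u∈W c vu → none (_ , mkM u∈W vu c)))
      ... | _ | no none | _ =
        inj₁ (free-column _ (λ u∈W c vu → none (_ , mkM u∈W vu c)))
      ... | _ | _ | no none =
        inj₁ (free-column _ (λ u∈W c vu → none (_ , mkM u∈W vu c)))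
      ... | yes (m₀ , M₀) | yes (m₁ , M₁) | yes (m₂ , M₂)
        with Linked? (N? zero) (N? (suc zero)) | Linked? (N? zero) (N? (suc (suc zero)))
           | Linked? (N? (suc zero)) (N? (suc (suc zero)))
      ... | yes l | yes l′ | yes l″ =
        ⊥-elim (noK₄ (M.vu M₀) (M.vu M₁) (M.vu M₂) (joined-M l M₀ M₁) (joined-M l′ M₀ M₂) (joined-M l″ M₁ M₂))
      ... | no ¬l | yes l′ | yes l″ =
        inj₁ (two-links (Others.covers (otherColumns (suc (suc zero)))) ¬l l′ l″ (m₂ , M₂))
      ... | yes l | no ¬l′ | yes l″ =
        inj₁ (two-links (Others.covers (otherColumns (suc zero))) ¬l′ l (joined-sym l″) (m₁ , M₁))
      ... | yes l | yes l′ | no ¬l″ =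
        inj₁ (two-links (Others.covers (otherColumns zero)) ¬l″ (joined-sym l) (joined-sym l′) (m₀ , M₀))
      ... | yes l | no ¬l′ | no ¬l″ = single-link (otherColumns (suc (suc zero))) l ¬l′ ¬l″
      ... | no ¬l | yes l′ | no ¬l″ = single-link (otherColumns (suc zero)) l′ ¬l (¬l″ ∘ joined-sym)
      ... | no ¬l | no ¬l′ | yes l″ =
        single-link (otherColumns zero) l″ (¬l ∘ joined-sym) (¬l′ ∘ joined-sym)
      ... | no ¬l | no ¬l′ | no ¬l″ = inj₁ (no-links none)
        where
        none : ∀ i j → ¬ Joined i j
        none zero             zero             (_ , _ , x , y , e) = NN x y e
        none (suc zero)       (suc zero)       (_ , _ , x , y , e) = NN x y e
        none (suc (suc zero)) (suc (suc zero)) (_ , _ , x , y , e) = NN x y e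
        none zero             (suc zero)       = ¬l
        none zero             (suc (suc zero)) = ¬l′
        none (suc zero)       (suc (suc zero)) = ¬l″
        none (suc zero)       zero             = ¬l ∘ joined-sym
        none (suc (suc zero)) zero             = ¬l′ ∘ joined-sym
        none (suc (suc zero)) (suc zero)       = ¬l″ ∘ joined-sym

    antihole-⊆ : ∀ {W W′} → W ⊆ W′ → Antihole W → Antihole W′
    antihole-⊆ i h = record
      { Antihole h
      ; c₀∈ = i c₀∈ ; c₁∈ = i c₁∈ ; c₂∈ = i c₂∈ ; c₃∈ = i c₃∈ ; c₄∈ = i c₄∈ ; c₅∈ = i c₅∈ ; c₆∈ = i c₆∈ }
      where open Antihole h

    three-colouring : ∀ {U : Pred V 0ℓ} → Decidable U →
                      (∃ λ (g : V → Fin 3) → ProperOn U g) ⊎ Antihole U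
    three-colouring {U} U? with go (allFin order)
      where
      go : ∀ xs → (∃ λ (g : V → Fin 3) → ProperOn (λ u → U u × u ∈ xs) g) ⊎ Antihole U
      go [] = inj₁ ((λ _ → zero) , λ { (_ , ()) })
      go (x ∷ xs) with go xs | U? x
      ... | inj₂ h | _ = inj₂ h
      ... | inj₁ (g , p) | no x∉U = inj₁ (g , λ u w → p (old u) (old w))
        where
        old : ∀ {u} → U u × u ∈ x ∷ xs → U u × u ∈ xs
        old (u∈U , here refl) = contradiction u∈U x∉U
        old (u∈U , there i)   = u∈U , i
      ... | inj₁ (g , p) | yes x∈U
        with Insert.insert (λ u → U? u ×-dec u ∈? xs) {g} p x
      ...   | inj₂ h = inj₂ (antihole-⊆ (λ { (inj₁ refl) → x∈U ; (inj₂ (u , _)) → u }) h)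
      ...   | inj₁ (g′ , p′) = inj₁ (g′ , λ u w → p′ (new u) (new w))
        where
        new : ∀ {u} → U u × u ∈ x ∷ xs → u ≡ x ⊎ U u × u ∈ xs
        new (_ , here u≡x)  = inj₁ u≡x
        new (u∈U , there i) = inj₂ (u∈U , i)
    ... | inj₁ (g , p) = inj₁ (g , λ u w → p (u , ∈-allFin _) (w , ∈-allFin _))
    ... | inj₂ h = inj₂ h

-- Non-adjacent vertices with nested neighbourhoods

module Comparable (G : Graph) where

  open Recolouring G

  module _ {ℓ : ℕ} {U : Pred V 0ℓ} {L : Pred (Fin ℓ) 0ℓ} {u v : V}
           (u≢v : u ≢ v) (u∈U : U u) (v∈U : U v) (¬uv : ¬ E u v)
           (N⊆N : ∀ {w} → U w → E u w → E v w) where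

    copy : (V → Fin ℓ) → V → Fin ℓ
    copy f = update f u (f v)

    copy-u : ∀ f → copy f u ≡ f v
    copy-u f = update-≡ f u (f v)

    copy-≢ : ∀ f {w} → w ≢ u → copy f w ≡ f w
    copy-≢ f = update-≢ f (f v)

    -- A step at `v` becomes two, `v` before `u`; meanwhile `u` keeps the old colour of `v`, which
    -- is harmless as the two are not adjacent. A neighbour of `u` that moves already avoids the
    -- colour of `v`, being its neighbour too.
    copy-step : ∀ {f g} → Step (U ∖ (_≡ u)) L f g → Reach U L (copy f) (copy g)
    copy-step {f} {g} s with vertex s ≟ v
    ... | no x≢v = record
      { vertex  = vertex s
      ; active  = proj₁ (active s)
      ; allowed = subst L (sym new) (allowed s)
      ; free    = λ w∈U e eq → free′ w∈U e (trans eq new)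
      ; others  = others′
      } ◅ ε
      where
      new : copy g (vertex s) ≡ g (vertex s)
      new = copy-≢ g (proj₂ (active s))

      free′ : ∀ {w} → U w → E (vertex s) w → copy f w ≢ g (vertex s)
      free′ {w} w∈U e with w ≟ u
      ... | yes refl = free s (v∈U , u≢v ∘ sym) (E-sym (N⊆N (proj₁ (active s)) (E-sym e)))
      ... | no  w≢u  = free s (w∈U , w≢u) e

      others′ : ∀ {w} → w ≢ vertex s → copy g w ≡ copy f w
      others′ {w} w≢x with w ≟ u
      ... | yes refl = others s (x≢v ∘ sym)
      ... | no  _    = others s w≢x
    ... | yes refl = first ◅ second ◅ ε
      where
      middle : V → Fin ℓ
      middle = update g u (f v)

      far : ∀ {w} → U w → E v w → w ≢ u
      far _ vw refl = ¬uv (E-sym vw)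

      first : Step U L (copy f) middle
      first = record
        { vertex  = v
        ; active  = v∈U
        ; allowed = subst L (sym (update-≢ g (f v) (u≢v ∘ sym))) (allowed s)
        ; free    = λ w∈U e eq → free s (w∈U , far w∈U e) e
            (trans (sym (copy-≢ f (far w∈U e))) (trans eq (update-≢ g (f v) (u≢v ∘ sym))))
        ; others  = others′
        }
        where
        others′ : ∀ {w} → w ≢ v → middle w ≡ copy f w
        others′ {w} w≢v with w ≟ u
        ... | yes _ = refl
        ... | no  _ = others s w≢v

      second : Step U L middle (copy g)
      second = record
        { vertex  = u
        ; active  = u∈U
        ; allowed = subst L (sym (copy-u g)) (allowed s)
        ; free    = λ w∈U e eq → free s (w∈U , far w∈U (N⊆N w∈U e)) (N⊆N w∈U e)
            (trans (sym (others s λ { refl → ¬uv e }))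
              (trans (sym (update-≢ g (f v) (far w∈U (N⊆N w∈U e)))) (trans eq (copy-u g))))
        ; others  = λ w≢u → trans (copy-≢ g w≢u) (sym (update-≢ g (f v) w≢u))
        }

    copy-reach : ∀ {f g} → Reach (U ∖ (_≡ u)) L f g → Reach U L (copy f) (copy g)
    copy-reach ε       = ε
    copy-reach (s ◅ r) = copy-step s ◅◅ copy-reach r

    -- Each recolouring of v is followed by the same recolouring of u.
    shrink-comparable : ∀ {f} → Proper U L f →
                        (Proper (U ∖ (_≡ u)) L f → Shrink (U ∖ (_≡ u)) L f) → Shrink U L f
    shrink-comparable {f} (pal , prop) rest =
      let g , c , r , c∈L , miss = rest ((λ (w , _) → pal w) , λ (x , _) (y , _) → prop x y)
      in  copy g , c , start ◅ copy-reach r , c∈L , miss′ {g} {c} miss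
      where
      start : Step U L f (copy f)
      start = update-step u∈U (pal v∈U) (λ w∈U e → prop v∈U w∈U (N⊆N w∈U e) ∘ sym)

      miss′ : ∀ {g c} → (∀ {w} → (U ∖ (_≡ u)) w → g w ≢ c) → ∀ {w} → U w → copy g w ≢ c
      miss′ {g} miss {w} w∈U with w ≟ u
      ... | yes refl = miss (v∈U , u≢v ∘ sym)
      ... | no  w≢u  = miss (w∈U , w≢u)

-- From losing a colour to connectivity

-- The value d is junk, taken for i ≥ k.
pick : ∀ {ℓ k} {L : Pred (Fin ℓ) 0ℓ} → Many k L → Fin ℓ → ℕ → Fin ℓ
pick {k = zero}  _           d _       = d
pick {k = suc k} (c , _ , _) d zero    = c
pick {k = suc k} (_ , _ , r) d (suc i) = pick {k = k} r d i

pick-∈ : ∀ {ℓ} k {L : Pred (Fin ℓ) 0ℓ} (r : Many k L) {d i} → i < k → L (pick {k = k} r d i)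
pick-∈ (suc k) (_ , c∈L , _) {i = zero}  _       = c∈L
pick-∈ (suc k) (_ , _ , r)   {i = suc i} (s≤s p) = proj₁ (pick-∈ k r p)

pick-injective : ∀ {ℓ} k {L : Pred (Fin ℓ) 0ℓ} (r : Many k L) {d i j} → i < k → j < k →
                 pick {k = k} r d i ≡ pick {k = k} r d j → i ≡ j
pick-injective (suc k) _ {i = zero} {zero} _ _ _ = refl
pick-injective (suc k) (_ , _ , r) {i = zero} {suc j} _ (s≤s q) eq =
  contradiction (sym eq) (proj₂ (pick-∈ k r q))
pick-injective (suc k) (_ , _ , r) {i = suc i} {zero} (s≤s p) _ eq =
  contradiction eq (proj₂ (pick-∈ k r p))
pick-injective (suc k) (_ , _ , r) {i = suc i} {suc j} (s≤s p) (s≤s q) eq =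
  cong suc (pick-injective k r p q eq)

module Connectivity (G : Graph) {ℓ : ℕ} where

  open Recolouring G

  CanShrink : Set₁
  CanShrink = ∀ k {U : Pred V 0ℓ} {L : Pred (Fin ℓ) 0ℓ} {γ : V → ℕ} {f} → Decidable U →
              (∀ {u} → U u → γ u < k) → ProperOn U γ → Many (suc k) L → Proper U L f → Shrink U L f

  -- Two paths may meet in colourings that agree only on `U`; the second path is then replayed from
  -- the actual end of the first.
  reach-from : ∀ {U L} {f g f′ : V → Fin ℓ} → (∀ {u} → U u → f′ u ≡ f u) → Reach U L f g →
               ∃ λ g′ → Reach U L f′ g′ × (∀ {u} → U u → g′ u ≡ g u)
  reach-from {f′ = f′} agree ε = f′ , ε , agree
  reach-from {U} {L} {f} {g} {f′} agree (_◅_ {j = h} s r) =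
    let g′ , r′ , agree′ = reach-from agreeₕ r in g′ , s′ ◅ r′ , agree′
    where
    x = vertex s

    s′ : Step U L f′ (update f′ x (h x))
    s′ = update-step (active s) (allowed s)
           (λ w∈U e eq → free s w∈U e (trans (sym (agree w∈U)) eq))

    agreeₕ : ∀ {u} → U u → update f′ x (h x) u ≡ h u
    agreeₕ {u} u∈U with u ≟ x
    ... | yes refl = refl
    ... | no  u≢x  = trans (agree u∈U) (sym (others s u≢x))

  module _ (canShrink : CanShrink) where

    Connected : Pred V 0ℓ → Pred (Fin ℓ) 0ℓ → Set
    Connected U L = ∀ {f h} → Proper U L f → Proper U L h →
                    ∃ λ g → Reach U L f g × (∀ {u} → U u → g u ≡ h u)

    connected : ∀ k {U : Pred V 0ℓ} {L : Pred (Fin ℓ) 0ℓ} {γ : V → ℕ} → Decidable U →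
                (∀ {u} → U u → γ u < k) → ProperOn U γ → Many (suc k) L → Connected U L
    connected zero U? γ<k γ-proper M {f} _ _ = f , ε , λ u∈U → contradiction (γ<k u∈U) λ ()
    connected (suc k) {U} {L} {γ} U? γ<k γ-proper M@(c₀ , c₀∈L , M₀) {f} {h} p q =
      let f′ , rf , pf , f₀ = normalise p
          h′ , rh , ph , h₀ = normalise q
          g , r , agree     = rest c₀ pf ph
          r′                = extend f₀ r
          x , r″ , agree″   = reach-from (agreeing f₀ h₀ r agree) (reach-sym q rh)
      in  x , rf ◅◅ r′ ◅◅ r″ , agree″
      where
      Top : Pred V 0ℓ
      Top u = γ u ≡ k

      Top? : Decidable Top
      Top? u = γ u ℕ.≟ k

      Rest : Pred V 0ℓ
      Rest = U ∖ Top

      Rest? = U? ∖? Top?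

      γ<k′ : ∀ {u} → Rest u → γ u < k
      γ<k′ (u∈U , ≢k) = ℕ.≤∧≢⇒< (ℕ.≤-pred (γ<k u∈U)) ≢k

      γ-separated : ProperOn Rest γ
      γ-separated (u , _) (w , _) = γ-proper u w

      rest : ∀ c → Connected Rest (L ∖ (_≡ c))
      rest c = connected k Rest? γ<k′ γ-separated (many-remove (suc k) M c)

      TopHas : Fin ℓ → (V → Fin ℓ) → Set
      TopHas c g = ∀ {u} → U u → Top u → g u ≡ c

      inTop : ∀ {u} → U u → ¬ Rest u → Top u
      inTop {u} u∈U ∉ = decidable-stable (Top? u) (λ ¬t → ∉ (u∈U , ¬t))

      extend : ∀ {c g g′} → TopHas c g → Reach Rest (L ∖ (_≡ c)) g g′ → Reach U L g g′
      extend top = reach-extend Rest? proj₁ proj₁ λ u∈U ∉ (_ , ≢c) → ≢c (top u∈U (inTop u∈U ∉))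

      agreeing : ∀ {c g h x} → TopHas c g → TopHas c h → Reach Rest (L ∖ (_≡ c)) g x →
                 (∀ {u} → Rest u → x u ≡ h u) → ∀ {u} → U u → x u ≡ h u
      agreeing gt ht r agree {u} u∈U with Top? u
      ... | no  ¬t = agree (u∈U , ¬t)
      ... | yes t  = trans (reach-outside r (λ (_ , ¬t) → ¬t t)) (trans (gt u∈U t) (sym (ht u∈U t)))

      recolourTop : ∀ {g c} → Proper U L g → L c → (∀ {u} → Rest u → g u ≢ c) →
                    ∃ λ g′ → Reach U L g g′ × Proper Rest (L ∖ (_≡ c)) g′ × TopHas c g′
      recolourTop {g} {c} p@(pal , prop) c∈L miss =
        result sw , reaches sw
        , ((λ x → subst (L ∖ (_≡ c)) (sym (keep x)) (pal (proj₁ x) , miss x))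
          , λ x y e eq → prop (proj₁ x) (proj₁ y) e (trans (sym (keep x)) (trans eq (keep y))))
        , λ u∈U t → swept sw (u∈U , t)
        where
        sw : Swept U L (λ u → U u × Top u) c g
        sw = sweep (λ u → U? u ×-dec Top? u) proj₁
               (λ (u , t) (w , t′) e → γ-proper u w e (trans t (sym t′))) c∈L
               (λ (u , t) w e → miss (w , λ t′ → γ-proper u w e (trans t (sym t′))))

        keep : ∀ {u} → Rest u → result sw u ≡ g u
        keep (_ , ¬t) = kept sw (¬t ∘ proj₂)

      -- The top class is first given a missing colour c; the rest is then recoloured
      -- without c and c₀, so that the top class can change to c₀.
      normalise : ∀ {g} → Proper U L g →
                  ∃ λ g′ → Reach U L g g′ × Proper Rest (L ∖ (_≡ c₀)) g′ × TopHas c₀ g′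
      normalise {g} p =
        let g₁ , c , r₁ , c∈L , miss = canShrink (suc k) U? γ<k γ-proper M p
            g₂ , r₂ , p₂ , top₂      = recolourTop (reach-proper r₁ p) c∈L (miss ∘ proj₁)
            -- `L` has at least k + 2 colours, so at least k remain without `c` and `c₀`, one for
            -- each class of `γ` below the top; `target` is `γ` written in these.
            Mc                       = many-remove k (many-remove (suc k) M c) c₀
            target                   = λ u → pick {k = k} Mc c₀ (γ u)
            g₃ , r₃ , agree          = rest c {h = target} p₂
              ( (λ x → proj₁ (pick-∈ k Mc (γ<k′ x)))
              , λ x y e eq → γ-separated x y e (pick-injective k Mc (γ<k′ x) (γ<k′ y) eq))
            r₁₃                      = r₁ ◅◅ r₂ ◅◅ extend top₂ r₃
            g₄ , r₄ , p₄ , top₄      = recolourTop (reach-proper r₁₃ p) c₀∈L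
              (λ x eq → proj₂ (pick-∈ k Mc (γ<k′ x)) (trans (sym (agree x)) eq))
        in  g₄ , r₁₃ ◅◅ r₄ , p₄ , top₄

-- Small graphs as bit tables, with enumeration of one-vertex extensions

-- A Code is a graph on m vertices, given by the adjacencies of each vertex to the later ones.
data Code : ℕ → Set where
  []  : Code 0
  _▷_ : ∀ {m} → Code m → Vec Bool m → Code (suc m)

infixl 5 _▷_

codeBy : ∀ {A : Set} {m} → (A → A → Bool) → Vec A m → Code m
codeBy r []       = []
codeBy r (x ∷ xs) = codeBy r xs ▷ Vec.map (r x) xs

entry : ∀ {m} → Code m → Fin m → Fin m → Bool
entry (A ▷ b) zero    zero    = false
entry (A ▷ b) zero    (suc j) = lookup b j
entry (A ▷ b) (suc i) zero    = lookup b i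
entry (A ▷ b) (suc i) (suc j) = entry A i j

-- Induced K₄ or 2K₂ on p, x, y, z, from the adjacencies px py pz xy xz yz.
four : Bool → Bool → Bool → Bool → Bool → Bool → Bool
four true  true  true  true  true  true  = true
four true  false false false false true  = true
four false true  false false true  false = true
four false false true  true  false false = true
four _     _     _     _     _     _     = false

-- Induced C₅ on p, x, y, z, w, from the adjacencies px py pz pw xy xz xw yz yw zw.
five : Bool → Bool → Bool → Bool → Bool → Bool → Bool → Bool → Bool → Bool → Bool
five true  false true  false true  false false false true  true  = true
five true  true  false false false true  false false true  true  = true
five true  false true  false false false true  true  true  false = true
five true  true  false false false false true  true  false true  = true
five false true  true  false true  false true  false false true  = true
five false true  true  false false true  true  false true  false = true
five false false true  true  true  false true  true  false false = true
five false true  false true  false true  true  true  false false = true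
five false false true  true  true  true  false false true  false = true
five true  false false true  false true  false true  true  false = true
five false true  false true  true  true  false false false true  = true
five true  false false true  true  false false true  false true  = true
five _ _ _ _ _ _ _ _ _ _ = false

-- The vectors b, c, a, d hold the adjacencies of x, p, y, z to the vertices of A.
clash₅ : ∀ {m} → Code m → (b c a d : Vec Bool m) (px xy py xz pz yz : Bool) → Bool
clash₅ []      []       []       []       []       px xy py xz pz yz = false
clash₅ (A ▷ _) (xw ∷ b) (pw ∷ c) (yw ∷ a) (zw ∷ d) px xy py xz pz yz =
  five px py pz pw xy xz xw yz yw zw ∨ clash₅ A b c a d px xy py xz pz yz

clash₄ : ∀ {m} → Code m → (b c a : Vec Bool m) (px xy py : Bool) → Bool
clash₄ []      []       []       []       px xy py = false
clash₄ (A ▷ d) (xz ∷ b) (pz ∷ c) (yz ∷ a) px xy py =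
  four px py pz xy xz yz ∨ (clash₅ A b c a d px xy py xz pz yz ∨ clash₄ A b c a px xy py)

-- Only copies containing both `p` and `x` are sought: those with `p` but without `x` were excluded
-- when `extensions` treated the smaller code. The other vertices are taken in list order, so each
-- set is tested once.
clash : ∀ {m} → Code m → (b c : Vec Bool m) (px : Bool) → Bool
clash []      []       []       px = false
clash (A ▷ a) (xy ∷ b) (py ∷ c) px = clash₄ A b c a px xy py ∨ clash A b c px

bothWays : ∀ {m} → List (Vec Bool m) → List (Vec Bool (suc m))
bothWays []       = []
bothWays (c ∷ cs) = (true ∷ c) ∷ (false ∷ c) ∷ bothWays cs

-- The adjacencies that a further vertex can have in a (2K₂, K₄, C₅)-free graph.
extensions : ∀ {m} → Code m → List (Vec Bool m)
extensions []      = [] ∷ []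
extensions (A ▷ b) = List.filter (λ c → clash A b (tail c) (head c) Bool.≟ false)
                       (bothWays (extensions A))

meets : ∀ {m} → List (Fin m × Bool) → Vec Bool m → Bool
meets []             c = true
meets ((i , t) ∷ cs) c = does (lookup c i Bool.≟ t) ∧ meets cs c

options : ∀ {m} → Code m → List (Fin m × Bool) → List (Vec Bool m)
options A cs = List.filter (λ c → meets cs c Bool.≟ true) (extensions A)

cyclicDistance : ℕ → ℕ → ℕ → ℕ
cyclicDistance m i j = ℕ.∣ i - j ∣ ℕ.⊓ (m ℕ.∸ ℕ.∣ i - j ∣)

-- This is the complement of the `k`-th power of the `m`-cycle.
circulant : ∀ m → ℕ → Code m
circulant m k = codeBy (λ i j → k ℕ.<ᵇ cyclicDistance m (toℕ i) (toℕ j)) (Vec.allFin m)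

-- The seven 4-arcs i, i+1, i+2, i+3 of the 7-cycle, as non-adjacencies.
arc : Fin 7 → Vec Bool 7
arc i = Vec.tabulate λ j → 4 ℕ.≤ᵇ (toℕ j ℕ.+ (7 ℕ.∸ toℕ i)) ℕ.% 7

row : ∀ {m} → Code m → Fin m → Vec Bool m
row A i = Vec.tabulate (entry A i)

Isolated : ∀ {m} → Vec Bool m → Set
Isolated {m} b = b ≡ Vec.replicate m false

IsRow : ∀ {m} → Code m → Vec Bool m → Set
IsRow A b = ∃ λ i → b ≡ row A i

IsArc : Vec Bool 7 → Set
IsArc b = ∃ λ i → b ≡ arc i

_≟ᵛ_ : ∀ {m} → Binary.DecidableEquality (Vec Bool m)
_≟ᵛ_ = Vec.≡-dec Bool._≟_

isolated? : ∀ {m} → Decidable (Isolated {m})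
isolated? {m} b = b ≟ᵛ Vec.replicate m false

isArc? : Decidable IsArc
isArc? b = any? λ i → b ≟ᵛ arc i

-- The two exceptional graphs

C₇ᶜ : Code 7
C₇ᶜ = circulant 7 1

-- The complement of the square of C₁₁.
C₁₁²ᶜ : Code 11
C₁₁²ᶜ = circulant 11 2

between : ∀ {m} → Fin m → Fin m → List (Fin m × Bool)
between i j = (i , true) ∷ (j , false) ∷ []

-- Decided by enumeration. An isolated vertex, or a twin of a vertex of the antihole, is comparable
-- unless yet another vertex separates the pair; an arc starts the passage to the complement of the
-- square of C₁₁.
C₇ᶜ-extensions : All (λ b → Isolated b ⊎ IsRow C₇ᶜ b ⊎ IsArc b) (extensions C₇ᶜ)
C₇ᶜ-extensions = from-yes (All.all?
  (λ b → isolated? b ⊎-dec any? (λ i → b ≟ᵛ row C₇ᶜ i) ⊎-dec isArc? b) (extensions C₇ᶜ))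

-- By 2K₂-freeness the vertices missed by a neighbour of the isolated vertex are independent, hence
-- at most two and consecutive; the other five contain a triangle, which completes a K₄.
C₇ᶜ-isolated : options (C₇ᶜ ▷ Vec.replicate 7 false) (between (# 0) (# 1)) ≡ []
C₇ᶜ-isolated = refl

C₇ᶜ-twin : ∀ i {b} → b ∈ options (C₇ᶜ ▷ row C₇ᶜ i) (between zero (suc i)) → IsArc (tail b)
C₇ᶜ-twin i b∈ = All.lookup (arcs i) b∈
  where
  arcs : ∀ i → All (λ b → IsArc (tail b)) (options (C₇ᶜ ▷ row C₇ᶜ i) (between zero (suc i)))
  arcs = from-yes (all? λ i →
    All.all? (λ b → isArc? (tail b)) (options (C₇ᶜ ▷ row C₇ᶜ i) (between zero (suc i))))

C₁₁²ᶜ-extensions : All (λ b → Isolated b ⊎ IsRow C₁₁²ᶜ b) (extensions C₁₁²ᶜ)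
C₁₁²ᶜ-extensions = from-yes (All.all?
  (λ b → isolated? b ⊎-dec any? (λ i → b ≟ᵛ row C₁₁²ᶜ i)) (extensions C₁₁²ᶜ))

-- Here at most three consecutive vertices are missed, and among eight consecutive ones `i`,
-- `i + 3`, `i + 6` form a triangle.
C₁₁²ᶜ-isolated : options (C₁₁²ᶜ ▷ Vec.replicate 11 false) (between (# 0) (# 1)) ≡ []
C₁₁²ᶜ-isolated = refl

C₁₁²ᶜ-twin : ∀ i {b} → ¬ b ∈ options (C₁₁²ᶜ ▷ row C₁₁²ᶜ i) (between zero (suc i))
C₁₁²ᶜ-twin i b∈ = All.lookup (none i) b∈
  where
  none : ∀ i → All (λ _ → ⊥) (options (C₁₁²ᶜ ▷ row C₁₁²ᶜ i) (between zero (suc i)))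
  none = from-yes (all? λ i →
    All.all? (λ _ → no id) (options (C₁₁²ᶜ ▷ row C₁₁²ᶜ i) (between zero (suc i))))

A₈ : Code 8
A₈ = C₇ᶜ ▷ arc zero

-- The vertex with the arc stays in front, and the cycle is turned until the arc starts at its first
-- vertex.
rotate : Fin 7 → Vec (Fin 8) 8
rotate i = zero ∷ Vec.tabulate λ j → suc (fromℕ< (m%n<n (toℕ j ℕ.+ toℕ i) 7))

rotate-arc : ∀ i → codeBy (entry (C₇ᶜ ▷ arc i)) (rotate i) ≡ A₈
rotate-arc zero = refl
rotate-arc (suc zero) = refl
rotate-arc (suc (suc zero)) = refl
rotate-arc (suc (suc (suc zero))) = refl
rotate-arc (suc (suc (suc (suc zero)))) = refl
rotate-arc (suc (suc (suc (suc (suc zero))))) = refl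
rotate-arc (suc (suc (suc (suc (suc (suc zero)))))) = refl

-- In A₈ the first vertex x is non-adjacent to c₀, …, c₃.  As x is not comparable with c₁
-- and c₂ there are y and z, and then w; circle₁ and circle₂ list the eleven vertices in
-- the cyclic order of C₁₁.  Each new vertex is put in front.
y₁ y₂ : Vec Bool 8
y₁ = true ∷ false ∷ false ∷ true ∷ true ∷ true ∷ true  ∷ false ∷ []
y₂ = true ∷ false ∷ false ∷ true ∷ true ∷ true ∷ false ∷ false ∷ []

z₁ z₂ : Vec Bool 9
z₁ = true ∷ true ∷ true ∷ true ∷ false ∷ false ∷ false ∷ false ∷ true ∷ []
z₂ = true ∷ true ∷ true ∷ true ∷ false ∷ false ∷ false ∷ true  ∷ true ∷ []

w₁ w₂ : Vec Bool 10
w₁ = true  ∷ false ∷ true ∷ true ∷ true ∷ true ∷ true ∷ false ∷ false ∷ false ∷ []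
w₂ = false ∷ true  ∷ true ∷ true ∷ true ∷ true ∷ true ∷ false ∷ false ∷ false ∷ []

-- Indices shift by one with each vertex put in front: the incomparable pairs used are x and c₁ for
-- y, x and c₂ for z, and then z and c₄ for `w₁`, or y and c₆ for `w₂`.
options-y : options A₈ (between (# 0) (# 2)) ≡ y₁ ∷ y₂ ∷ []
options-y = refl

options-z₁ : options (A₈ ▷ y₁) (between (# 1) (# 4)) ≡ z₁ ∷ []
options-z₁ = refl

options-z₂ : options (A₈ ▷ y₂) (between (# 1) (# 4)) ≡ z₂ ∷ []
options-z₂ = refl

options-w₁ : options (A₈ ▷ y₁ ▷ z₁) (between (# 0) (# 7)) ≡ w₁ ∷ []
options-w₁ = refl

options-w₂ : options (A₈ ▷ y₂ ▷ z₂) (between (# 1) (# 9)) ≡ w₂ ∷ []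
options-w₂ = refl

circle₁ circle₂ : Vec (Fin 11) 11
circle₁ = # 2 ∷ # 4 ∷ # 5 ∷ # 3 ∷ # 6 ∷ # 7 ∷ # 1 ∷ # 8  ∷ # 9 ∷ # 0 ∷ # 10 ∷ []
circle₂ = # 1 ∷ # 7 ∷ # 6 ∷ # 3 ∷ # 5 ∷ # 4 ∷ # 2 ∷ # 10 ∷ # 9 ∷ # 0 ∷ # 8  ∷ []

circle₁-code : codeBy (entry (A₈ ▷ y₁ ▷ z₁ ▷ w₁)) circle₁ ≡ C₁₁²ᶜ
circle₁-code = refl

circle₂-code : codeBy (entry (A₈ ▷ y₂ ▷ z₂ ▷ w₂)) circle₂ ≡ C₁₁²ᶜ
circle₂-code = refl

ProperCode : ∀ {m} → Code m → Vec (Fin 4) m → Set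
ProperCode A ρ = ∀ i j → lookup ρ i ≡ lookup ρ j → entry A i j ≡ false

properCode? : ∀ {m} (A : Code m) ρ → Dec (ProperCode A ρ)
properCode? A ρ = all? λ i → all? λ j → (lookup ρ i ≟ lookup ρ j) →-dec (entry A i j Bool.≟ false)

-- Proper 4-colourings whose colour 0 is the set of consecutive vertices in the index.
colours₀₁ colours₆₀ : Vec (Fin 4) 7
colours₀₁ = # 0 ∷ # 0 ∷ # 1 ∷ # 1 ∷ # 2 ∷ # 2 ∷ # 3 ∷ []
colours₆₀ = # 0 ∷ # 1 ∷ # 1 ∷ # 2 ∷ # 2 ∷ # 3 ∷ # 0 ∷ []

colours₀₁₂ colours₁₀₀₁ colours₉₁₀₀ : Vec (Fin 4) 11
colours₀₁₂  = # 0 ∷ # 0 ∷ # 0 ∷ # 1 ∷ # 1 ∷ # 1 ∷ # 2 ∷ # 2 ∷ # 2 ∷ # 3 ∷ # 3 ∷ []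
colours₁₀₀₁ = # 0 ∷ # 0 ∷ # 1 ∷ # 1 ∷ # 1 ∷ # 2 ∷ # 2 ∷ # 2 ∷ # 3 ∷ # 3 ∷ # 0 ∷ []
colours₉₁₀₀ = # 0 ∷ # 1 ∷ # 1 ∷ # 1 ∷ # 2 ∷ # 2 ∷ # 2 ∷ # 3 ∷ # 3 ∷ # 0 ∷ # 0 ∷ []

colours₀₁-proper : ProperCode C₇ᶜ colours₀₁
colours₀₁-proper = from-yes (properCode? C₇ᶜ colours₀₁)

colours₆₀-proper : ProperCode C₇ᶜ colours₆₀
colours₆₀-proper = from-yes (properCode? C₇ᶜ colours₆₀)

colours₀₁₂-proper : ProperCode C₁₁²ᶜ colours₀₁₂
colours₀₁₂-proper = from-yes (properCode? C₁₁²ᶜ colours₀₁₂)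

colours₁₀₀₁-proper : ProperCode C₁₁²ᶜ colours₁₀₀₁
colours₁₀₀₁-proper = from-yes (properCode? C₁₁²ᶜ colours₁₀₀₁)

colours₉₁₀₀-proper : ProperCode C₁₁²ᶜ colours₉₁₀₀
colours₉₁₀₀-proper = from-yes (properCode? C₁₁²ᶜ colours₉₁₀₀)

NonAdj : ∀ {m} → Code m → Fin m → Fin m → Set
NonAdj A i j = entry A i j ≡ false

nonAdj? : ∀ {m} (A : Code m) i j → Dec (NonAdj A i j)
nonAdj? A i j = entry A i j Bool.≟ false

-- Independent sets through vertex 0 lie in runs of two consecutive vertices here, and of three in
-- the larger graph. Whether a colour class contains 1, or 2 and then 1, tells which run contains
-- it.
colours₀₁-class : ∀ i → NonAdj C₇ᶜ (# 0) i → NonAdj C₇ᶜ (# 1) i → lookup colours₀₁ i ≡ zero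
colours₀₁-class = from-yes (all? λ i →
  nonAdj? C₇ᶜ (# 0) i →-dec nonAdj? C₇ᶜ (# 1) i →-dec lookup colours₀₁ i ≟ zero)

colours₆₀-class : ∀ i → NonAdj C₇ᶜ (# 0) i → i ≢ # 1 → lookup colours₆₀ i ≡ zero
colours₆₀-class = from-yes (all? λ i →
  nonAdj? C₇ᶜ (# 0) i →-dec ¬? (i ≟ # 1) →-dec lookup colours₆₀ i ≟ zero)

colours₀₁₂-class : ∀ i → NonAdj C₁₁²ᶜ (# 0) i → NonAdj C₁₁²ᶜ (# 2) i → lookup colours₀₁₂ i ≡ zero
colours₀₁₂-class = from-yes (all? λ i →
  nonAdj? C₁₁²ᶜ (# 0) i →-dec nonAdj? C₁₁²ᶜ (# 2) i →-dec lookup colours₀₁₂ i ≟ zero)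

colours₁₀₀₁-class : ∀ i → NonAdj C₁₁²ᶜ (# 0) i → NonAdj C₁₁²ᶜ (# 1) i → i ≢ # 2 →
                    lookup colours₁₀₀₁ i ≡ zero
colours₁₀₀₁-class = from-yes (all? λ i → nonAdj? C₁₁²ᶜ (# 0) i →-dec nonAdj? C₁₁²ᶜ (# 1) i →-dec
  ¬? (i ≟ # 2) →-dec lookup colours₁₀₀₁ i ≟ zero)

colours₉₁₀₀-class : ∀ i → NonAdj C₁₁²ᶜ (# 0) i → i ≢ # 1 → i ≢ # 2 → lookup colours₉₁₀₀ i ≡ zero
colours₉₁₀₀-class = from-yes (all? λ i → nonAdj? C₁₁²ᶜ (# 0) i →-dec
  ¬? (i ≟ # 1) →-dec ¬? (i ≟ # 2) →-dec lookup colours₉₁₀₀ i ≟ zero)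

-- Realising codes by lists of vertices

module Codes (G : Graph) where

  open Recolouring G

  adj : V → V → Bool
  adj u v = does (E? u v)

  edge : ∀ {u v} → adj u v ≡ true → E u v
  edge {u} {v} eq with E? u v
  ... | yes e = e

  nonedge : ∀ {u v} → adj u v ≡ false → ¬ E u v
  nonedge {u} {v} eq with E? u v
  ... | no ¬e = ¬e

  adj-true : ∀ {u v} → E u v → adj u v ≡ true
  adj-true {u} {v} = dec-true (E? u v)

  adj-false : ∀ {u v} → ¬ E u v → adj u v ≡ false
  adj-false {u} {v} = dec-false (E? u v)

  infixr 5 _∷ᵉ_
  _∷ᵉ_ : ∀ {m s t} {b c : Vec Bool m} → s ≡ t → b ≡ c → (s ∷ b) ≡ (t ∷ c)
  _∷ᵉ_ = cong₂ _∷_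

  adj-sym : ∀ u v → adj u v ≡ adj v u
  adj-sym u v with E? u v
  ... | yes e = sym (dec-true (E? v u) (E-sym e))
  ... | no ¬e = sym (dec-false (E? v u) (¬e ∘ E-sym))

  code : ∀ {m} → Vec V m → Code m
  code = codeBy adj

  bits : ∀ {m} → V → Vec V m → Vec Bool m
  bits p = Vec.map (adj p)

  record _⊨_ {m} (xs : Vec V m) (A : Code m) : Set where
    constructor realises
    field code≡ : code xs ≡ A

  ⊨-∷ : ∀ {m p} {xs : Vec V m} {A b} → xs ⊨ A → bits p xs ≡ b → (p ∷ xs) ⊨ (A ▷ b)
  ⊨-∷ (realises refl) refl = realises refl

  ⊨-≡ : ∀ {m} {xs : Vec V m} {A B} → xs ⊨ A → A ≡ B → xs ⊨ B
  ⊨-≡ ⊨A refl = ⊨A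

  codeBy-cong : ∀ {A : Set} {m} {r s : A → A → Bool} → (∀ i j → r i j ≡ s i j) →
                (xs : Vec A m) → codeBy r xs ≡ codeBy s xs
  codeBy-cong eq []       = refl
  codeBy-cong eq (x ∷ xs) = cong₂ _▷_ (codeBy-cong eq xs) (Vec.map-cong (eq x) xs)

  codeBy-map : ∀ {A B : Set} {m} (r : B → B → Bool) (h : A → B) (xs : Vec A m) →
               codeBy r (Vec.map h xs) ≡ codeBy (λ i j → r (h i) (h j)) xs
  codeBy-map r h []       = refl
  codeBy-map r h (x ∷ xs) = cong₂ _▷_ (codeBy-map r h xs) (sym (Vec.map-∘ (r (h x)) h xs))

  entry-code : ∀ {m} (xs : Vec V m) i j → adj (lookup xs i) (lookup xs j) ≡ entry (code xs) i j
  entry-code (x ∷ xs) zero    zero    = dec-false (E? x x) (E-irrefl x)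
  entry-code (x ∷ xs) zero    (suc j) = sym (Vec.lookup-map j (adj x) xs)
  entry-code (x ∷ xs) (suc i) zero    =
    trans (adj-sym (lookup xs i) x) (sym (Vec.lookup-map i (adj x) xs))
  entry-code (x ∷ xs) (suc i) (suc j) = entry-code xs i j

  ⊨-entry : ∀ {m} {xs : Vec V m} {A} → xs ⊨ A → ∀ i j → adj (lookup xs i) (lookup xs j) ≡ entry A i j
  ⊨-entry {xs = xs} (realises refl) = entry-code xs

  select : ∀ {m k} → Vec V m → Vec (Fin m) k → Vec V k
  select xs π = Vec.map (lookup xs) π

  ⊨-select : ∀ {m k} {xs : Vec V m} {A} → xs ⊨ A → (π : Vec (Fin m) k) →
             select xs π ⊨ codeBy (entry A) π
  ⊨-select {xs = xs} ⊨A π =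
    realises (trans (codeBy-map adj (lookup xs) π) (codeBy-cong (⊨-entry ⊨A) π))

  record Inside {m} (U : Pred V 0ℓ) (xs : Vec V m) : Set where
    constructor inside
    field at : ∀ i → U (lookup xs i)

  open Inside public

  inside-∷ : ∀ {m U p} {xs : Vec V m} → U p → Inside U xs → Inside U (p ∷ xs)
  inside-∷ p∈U xs∈U = inside λ { zero → p∈U ; (suc i) → at xs∈U i }

  inside-select : ∀ {m k U} {xs : Vec V m} → Inside U xs → (π : Vec (Fin m) k) →
                  Inside U (select xs π)
  inside-select {U = U} {xs} xs∈U π = inside λ i →
    subst U (sym (Vec.lookup-map i (lookup xs) π)) (at xs∈U (lookup π i))

-- Graphs without comparable pairs that contain the complement of C₇

module Extensions (G : Graph) (no2K₂ : Columns.2K₂-free G)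
                  (noK₄ : ThreeColouring.K₄-free G) (noC₅ : ThreeColouring.C₅-free G) where

  open Recolouring G
  open Codes G

  four-free : ∀ {p x y z} {px′ py′ pz′ xy′ xz′ yz′} →
              adj p x ≡ px′ → adj p y ≡ py′ → adj p z ≡ pz′ →
              adj x y ≡ xy′ → adj x z ≡ xz′ → adj y z ≡ yz′ →
              ¬ four px′ py′ pz′ xy′ xz′ yz′ ≡ true
  four-free {px′ = true}  {true}  {true}  {true}  {true}  {true}  px py pz xy xz yz _ =
    noK₄ (edge px) (edge py) (edge pz) (edge xy) (edge xz) (edge yz)
  four-free {px′ = true}  {false} {false} {false} {false} {true}  px py pz xy xz yz _ =
    no2K₂ (edge px) (edge yz) (nonedge py) (nonedge pz) (nonedge xy) (nonedge xz)
  four-free {px′ = false} {true}  {false} {false} {true}  {false} px py pz xy xz yz _ =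
    no2K₂ (edge py) (edge xz) (nonedge px) (nonedge pz) (nonedge xy ∘ E-sym) (nonedge yz)
  four-free {px′ = false} {false} {true}  {true}  {false} {false} px py pz xy xz yz _ =
    no2K₂ (edge pz) (edge xy) (nonedge px) (nonedge py) (nonedge xz ∘ E-sym) (nonedge yz ∘ E-sym)

  -- Each clause is one of the 4!/2 = 12 cyclic orders of five vertices, walked around to supply the
  -- edges and then the chords.
  five-free : ∀ {p x y z w} {px′ py′ pz′ pw′ xy′ xz′ xw′ yz′ yw′ zw′} →
              adj p x ≡ px′ → adj p y ≡ py′ → adj p z ≡ pz′ → adj p w ≡ pw′ →
              adj x y ≡ xy′ → adj x z ≡ xz′ → adj x w ≡ xw′ →
              adj y z ≡ yz′ → adj y w ≡ yw′ → adj z w ≡ zw′ →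
              ¬ five px′ py′ pz′ pw′ xy′ xz′ xw′ yz′ yw′ zw′ ≡ true
  five-free {px′ = true} {false} {true} {false} {true} {false} {false} {false} {true} {true}
    px py pz pw xy xz xw yz yw zw _ =
    noC₅ (edge px) (edge xy) (edge yw) (E-sym (edge zw)) (E-sym (edge pz)) (nonedge py) (nonedge pw) (nonedge xw) (nonedge xz) (nonedge yz)
  five-free {px′ = true} {true} {false} {false} {false} {true} {false} {false} {true} {true}
    px py pz pw xy xz xw yz yw zw _ =
    noC₅ (edge px) (edge xz) (edge zw) (E-sym (edge yw)) (E-sym (edge py)) (nonedge pz) (nonedge pw) (nonedge xw) (nonedge xy) (nonedge yz ∘ E-sym)
  five-free {px′ = true} {false} {true} {false} {false} {false} {true} {true} {true} {false}
    px py pz pw xy xz xw yz yw zw _ =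
    noC₅ (edge px) (edge xw) (E-sym (edge yw)) (edge yz) (E-sym (edge pz)) (nonedge pw) (nonedge py) (nonedge xy) (nonedge xz) (nonedge zw ∘ E-sym)
  five-free {px′ = true} {true} {false} {false} {false} {false} {true} {true} {false} {true}
    px py pz pw xy xz xw yz yw zw _ =
    noC₅ (edge px) (edge xw) (E-sym (edge zw)) (E-sym (edge yz)) (E-sym (edge py)) (nonedge pw) (nonedge pz) (nonedge xz) (nonedge xy) (nonedge yw ∘ E-sym)
  five-free {px′ = false} {true} {true} {false} {true} {false} {true} {false} {false} {true}
    px py pz pw xy xz xw yz yw zw _ =
    noC₅ (edge py) (E-sym (edge xy)) (edge xw) (E-sym (edge zw)) (E-sym (edge pz)) (nonedge px) (nonedge pw) (nonedge yw) (nonedge yz) (nonedge xz)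
  five-free {px′ = false} {true} {true} {false} {false} {true} {true} {false} {true} {false}
    px py pz pw xy xz xw yz yw zw _ =
    noC₅ (edge py) (edge yw) (E-sym (edge xw)) (edge xz) (E-sym (edge pz)) (nonedge pw) (nonedge px) (nonedge xy ∘ E-sym) (nonedge yz) (nonedge zw ∘ E-sym)
  five-free {px′ = false} {false} {true} {true} {true} {false} {true} {true} {false} {false}
    px py pz pw xy xz xw yz yw zw _ =
    noC₅ (edge pw) (E-sym (edge xw)) (edge xy) (edge yz) (E-sym (edge pz)) (nonedge px) (nonedge py) (nonedge yw ∘ E-sym) (nonedge zw ∘ E-sym) (nonedge xz)
  five-free {px′ = false} {true} {false} {true} {false} {true} {true} {true} {false} {false}
    px py pz pw xy xz xw yz yw zw _ =
    noC₅ (edge pw) (E-sym (edge xw)) (edge xz) (E-sym (edge yz)) (E-sym (edge py)) (nonedge px) (nonedge pz) (nonedge zw ∘ E-sym) (nonedge yw ∘ E-sym) (nonedge xy)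
  five-free {px′ = false} {false} {true} {true} {true} {true} {false} {false} {true} {false}
    px py pz pw xy xz xw yz yw zw _ =
    noC₅ (edge pw) (E-sym (edge yw)) (E-sym (edge xy)) (edge xz) (E-sym (edge pz)) (nonedge py) (nonedge px) (nonedge xw ∘ E-sym) (nonedge zw ∘ E-sym) (nonedge yz)
  five-free {px′ = true} {false} {false} {true} {false} {true} {false} {true} {true} {false}
    px py pz pw xy xz xw yz yw zw _ =
    noC₅ (edge pw) (E-sym (edge yw)) (edge yz) (E-sym (edge xz)) (E-sym (edge px)) (nonedge py) (nonedge pz) (nonedge zw ∘ E-sym) (nonedge xw ∘ E-sym) (nonedge xy ∘ E-sym)
  five-free {px′ = false} {true} {false} {true} {true} {true} {false} {false} {false} {true}
    px py pz pw xy xz xw yz yw zw _ =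
    noC₅ (edge pw) (E-sym (edge zw)) (E-sym (edge xz)) (edge xy) (E-sym (edge py)) (nonedge pz) (nonedge px) (nonedge xw ∘ E-sym) (nonedge yw ∘ E-sym) (nonedge yz ∘ E-sym)
  five-free {px′ = true} {false} {false} {true} {true} {false} {false} {true} {false} {true}
    px py pz pw xy xz xw yz yw zw _ =
    noC₅ (edge pw) (E-sym (edge zw)) (E-sym (edge yz)) (E-sym (edge xy)) (E-sym (edge px)) (nonedge pz) (nonedge py) (nonedge yw ∘ E-sym) (nonedge xw ∘ E-sym) (nonedge xz ∘ E-sym)
  clash₅-free : ∀ {m} p x y z (xs : Vec V m) →
                clash₅ (code xs) (bits x xs) (bits p xs) (bits y xs) (bits z xs)
                  (adj p x) (adj x y) (adj p y) (adj x z) (adj p z) (adj y z) ≡ false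
  clash₅-free p x y z []       = refl
  clash₅-free p x y z (w ∷ xs) =
    cong₂ _∨_ (Bool.¬-not (five-free {p} {x} {y} {z} {w}
      refl refl refl refl refl refl refl refl refl refl)) (clash₅-free p x y z xs)

  clash₄-free : ∀ {m} p x y (xs : Vec V m) →
                clash₄ (code xs) (bits x xs) (bits p xs) (bits y xs)
                  (adj p x) (adj x y) (adj p y) ≡ false
  clash₄-free p x y []       = refl
  clash₄-free p x y (z ∷ xs) =
    cong₂ _∨_ (Bool.¬-not (four-free {p} {x} {y} {z} refl refl refl refl refl refl))
      (cong₂ _∨_ (clash₅-free p x y z xs) (clash₄-free p x y xs))

  clash-free : ∀ {m} p x (xs : Vec V m) → clash (code xs) (bits x xs) (bits p xs) (adj p x) ≡ false
  clash-free p x []       = refl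
  clash-free p x (y ∷ xs) = cong₂ _∨_ (clash₄-free p x y xs) (clash-free p x xs)

  ∈-bothWays : ∀ {m} {c : Vec Bool m} {cs} t → c ∈ cs → (t ∷ c) ∈ bothWays cs
  ∈-bothWays true  (here refl) = here refl
  ∈-bothWays false (here refl) = there (here refl)
  ∈-bothWays t     (there i)   = there (there (∈-bothWays t i))

  ∈-extensions : ∀ {m} p (xs : Vec V m) → bits p xs ∈ extensions (code xs)
  ∈-extensions p []       = here refl
  ∈-extensions p (x ∷ xs) =
    ∈-filter⁺ _ (∈-bothWays (adj p x) (∈-extensions p xs)) (clash-free p x xs)

  module Incomparable {U : Pred V 0ℓ} (U? : Decidable U)
    (incomparable : ∀ {u v} → u ≢ v → U u → U v → ¬ E u v → ∃ λ w → U w × E u w × ¬ E v w) where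

    witness : ∀ {m} {xs : Vec V m} {A} → xs ⊨ A → Inside U xs → ∀ i j →
              lookup xs i ≢ lookup xs j → entry A i j ≡ false →
              ∀ {os} → options A (between i j) ≡ os → ∃ λ w → U w × bits w xs ∈ os
    witness {xs = xs} {A} (realises refl) xs∈U i j i≢j ij refl =
      let w , w∈U , iw , ¬jw =
            incomparable i≢j (at xs∈U i) (at xs∈U j) (nonedge (trans (⊨-entry {xs = xs} (realises refl) i j) ij))
      in  w , w∈U , ∈-filter⁺ _ (∈-extensions w xs) (meets-between w iw ¬jw)
      where
      meets-between : ∀ w → E (lookup xs i) w → ¬ E (lookup xs j) w →
                      meets (between i j) (bits w xs) ≡ true
      meets-between w iw ¬jw
        rewrite Vec.lookup-map i (adj w) xs | Vec.lookup-map j (adj w) xs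
              | dec-true (E? w (lookup xs i)) (E-sym iw)
              | dec-false (E? w (lookup xs j)) (¬jw ∘ E-sym) = refl

    -- A list realising a code might repeat a vertex; the entry at `k`, adjacent to that at `j` but
    -- not to that at `i`, tells the two apart.
    witness-apart : ∀ {m} {xs : Vec V m} {A} → xs ⊨ A → Inside U xs → ∀ i j k →
               entry A i j ≡ false → entry A i k ≡ false → entry A j k ≡ true →
               ∀ {os} → options A (between i j) ≡ os → ∃ λ w → U w × bits w xs ∈ os
    witness-apart {xs = xs} ⊨A xs∈U i j k ij ik jk = witness ⊨A xs∈U i j apart ij
      where
      apart : lookup xs i ≢ lookup xs j
      apart eq = nonedge (trans (⊨-entry ⊨A i k) ik)
        (subst (λ x → E x (lookup xs k)) (sym eq) (edge (trans (⊨-entry ⊨A j k) jk)))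

    record Spanning {m} (A : Code m) : Set where
      field
        {vertices} : Vec V m
        realised   : vertices ⊨ A
        contained  : Inside U vertices
        spanning   : ∀ {u} → U u → ∃ λ i → u ≡ lookup vertices i

    entry-diagonal : ∀ {m} (A : Code m) i → entry A i i ≡ false
    entry-diagonal (A ▷ b) zero    = refl
    entry-diagonal (A ▷ b) (suc i) = entry-diagonal A i

    twin-witness : ∀ {m} {xs : Vec V m} {A p} i → xs ⊨ A → Inside U xs → U p →
                   (∀ j → p ≢ lookup xs j) → bits p xs ≡ row A i →
                   ∃ λ w → U w × bits w (p ∷ xs) ∈ options (A ▷ row A i) (between zero (suc i))
    twin-witness {A = A} {p} i ⊨A xs∈U p∈U new eq =
      witness (⊨-∷ ⊨A eq) (inside-∷ p∈U xs∈U) zero (suc i) (new i)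
        (trans (Vec.lookup∘tabulate (entry A i) i) (entry-diagonal A i)) refl

    ∈-extensions-of : ∀ {m} {xs : Vec V m} {A} → xs ⊨ A → ∀ p → bits p xs ∈ extensions A
    ∈-extensions-of (realises refl) p = ∈-extensions p _

    C₁₁²ᶜ-new : ∀ {xs p} → xs ⊨ C₁₁²ᶜ → Inside U xs → U p → (∀ j → p ≢ lookup xs j) →
                Isolated (bits p xs) ⊎ IsRow C₁₁²ᶜ (bits p xs) → ⊥
    C₁₁²ᶜ-new ⊨A xs∈U p∈U new (inj₁ isolated)
      with witness-apart (⊨-∷ ⊨A isolated) (inside-∷ p∈U xs∈U) (# 0) (# 1) (# 4) refl refl refl
             C₁₁²ᶜ-isolated
    ... | _ , _ , ()
    C₁₁²ᶜ-new ⊨A xs∈U p∈U new (inj₂ (i , eq)) =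
      C₁₁²ᶜ-twin i (proj₂ (proj₂ (twin-witness i ⊨A xs∈U p∈U new eq)))

    spans-unless : ∀ {m} (xs : Vec V m) → (∀ {p} → U p → (∀ j → p ≢ lookup xs j) → ⊥) →
                   ∀ {p} → U p → ∃ λ i → p ≡ lookup xs i
    spans-unless xs no-new {p} p∈U = decidable-stable (any? λ i → p ≟ lookup xs i)
      λ new → no-new p∈U λ j eq → new (j , eq)

    spanning-C₁₁²ᶜ : ∀ {xs} → xs ⊨ C₁₁²ᶜ → Inside U xs → Spanning C₁₁²ᶜ
    spanning-C₁₁²ᶜ {xs} ⊨A xs∈U = record
      { realised  = ⊨A
      ; contained = xs∈U
      ; spanning  = spans-unless xs λ p∈U new → C₁₁²ᶜ-new ⊨A xs∈U p∈U new
          (All.lookup C₁₁²ᶜ-extensions (∈-extensions-of ⊨A _))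
      }

    extend-A₈ : ∀ {xs} → xs ⊨ A₈ → Inside U xs → Spanning C₁₁²ᶜ
    extend-A₈ {xs} ⊨A xs∈U
      with witness-apart ⊨A xs∈U (# 0) (# 2) (# 4) refl refl refl options-y
    ... | y , y∈U , here y≡
      with witness-apart (⊨-∷ ⊨A y≡) (inside-∷ y∈U xs∈U) (# 1) (# 4) (# 2) refl refl refl options-z₁
    ... | z , z∈U , here z≡
      with witness-apart (⊨-∷ (⊨-∷ ⊨A y≡) z≡) (inside-∷ z∈U (inside-∷ y∈U xs∈U)) (# 0) (# 7) (# 5)
             refl refl refl options-w₁
    ... | w , w∈U , here w≡ = spanning-C₁₁²ᶜ
      (⊨-≡ (⊨-select (⊨-∷ (⊨-∷ (⊨-∷ ⊨A y≡) z≡) w≡) circle₁) circle₁-code)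
      (inside-select (inside-∷ w∈U (inside-∷ z∈U (inside-∷ y∈U xs∈U))) circle₁)
    extend-A₈ {xs} ⊨A xs∈U | y , y∈U , there (here y≡)
      with witness-apart (⊨-∷ ⊨A y≡) (inside-∷ y∈U xs∈U) (# 1) (# 4) (# 2) refl refl refl options-z₂
    ... | z , z∈U , here z≡
      with witness-apart (⊨-∷ (⊨-∷ ⊨A y≡) z≡) (inside-∷ z∈U (inside-∷ y∈U xs∈U)) (# 1) (# 9) (# 4)
             refl refl refl options-w₂
    ... | w , w∈U , here w≡ = spanning-C₁₁²ᶜ
      (⊨-≡ (⊨-select (⊨-∷ (⊨-∷ (⊨-∷ ⊨A y≡) z≡) w≡) circle₂) circle₂-code)
      (inside-select (inside-∷ w∈U (inside-∷ z∈U (inside-∷ y∈U xs∈U))) circle₂)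

    C₇ᶜ-new : ∀ {xs p} → xs ⊨ C₇ᶜ → Inside U xs → U p → (∀ j → p ≢ lookup xs j) →
              ¬ (∃ λ x → U x × IsArc (bits x xs)) →
              Isolated (bits p xs) ⊎ IsRow C₇ᶜ (bits p xs) ⊎ IsArc (bits p xs) → ⊥
    C₇ᶜ-new ⊨A xs∈U p∈U new no-arcs (inj₁ isolated)
      with witness-apart (⊨-∷ ⊨A isolated) (inside-∷ p∈U xs∈U) (# 0) (# 1) (# 4) refl refl refl
             C₇ᶜ-isolated
    ... | _ , _ , ()
    C₇ᶜ-new ⊨A xs∈U p∈U new no-arcs (inj₂ (inj₂ is-arc)) = no-arcs (_ , p∈U , is-arc)
    C₇ᶜ-new ⊨A xs∈U p∈U new no-arcs (inj₂ (inj₁ (i , eq)))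
      with twin-witness i ⊨A xs∈U p∈U new eq
    ... | w , w∈U , w∈ = no-arcs (w , w∈U , C₇ᶜ-twin i w∈)

    spanning-C₇ᶜ : ∀ {xs} → xs ⊨ C₇ᶜ → Inside U xs → Spanning C₇ᶜ ⊎ Spanning C₁₁²ᶜ
    spanning-C₇ᶜ {xs} ⊨A xs∈U with any? (λ x → U? x ×-dec isArc? (bits x xs))
    ... | yes (x , x∈U , i , x≡) = inj₂ (extend-A₈
      (⊨-≡ (⊨-select (⊨-∷ ⊨A x≡) (rotate i)) (rotate-arc i))
      (inside-select (inside-∷ x∈U xs∈U) (rotate i)))
    ... | no no-arcs = inj₁ record
      { realised  = ⊨A
      ; contained = xs∈U
      ; spanning  = spans-unless xs λ p∈U new → C₇ᶜ-new ⊨A xs∈U p∈U new no-arcs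
          (All.lookup C₇ᶜ-extensions (∈-extensions-of ⊨A _))
      }

    antihole-spanning : ThreeColouring.Antihole G U → Spanning C₇ᶜ ⊎ Spanning C₁₁²ᶜ
    antihole-spanning h = spanning-C₇ᶜ {c₀ ∷ c₁ ∷ c₂ ∷ c₃ ∷ c₄ ∷ c₅ ∷ c₆ ∷ []} ⊨A contained
      where
      open ThreeColouring.Antihole h

      ⊨A : (c₀ ∷ c₁ ∷ c₂ ∷ c₃ ∷ c₄ ∷ c₅ ∷ c₆ ∷ []) ⊨ C₇ᶜ
      ⊨A = ⊨-∷ (⊨-∷ (⊨-∷ (⊨-∷ (⊨-∷ (⊨-∷ (⊨-∷ (realises refl) refl)
        (adj-false ¬e₅₆ ∷ᵉ refl))
        (adj-false ¬e₄₅ ∷ᵉ adj-true e₄₆ ∷ᵉ refl))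
        (adj-false ¬e₃₄ ∷ᵉ adj-true e₃₅ ∷ᵉ adj-true e₃₆ ∷ᵉ refl))
        (adj-false ¬e₂₃ ∷ᵉ adj-true e₂₄ ∷ᵉ adj-true e₂₅ ∷ᵉ adj-true e₂₆ ∷ᵉ refl))
        (adj-false ¬e₁₂ ∷ᵉ adj-true e₁₃ ∷ᵉ adj-true e₁₄ ∷ᵉ adj-true e₁₅ ∷ᵉ adj-true e₁₆ ∷ᵉ refl))
        (adj-false ¬e₀₁ ∷ᵉ adj-true e₀₂ ∷ᵉ adj-true e₀₃ ∷ᵉ adj-true e₀₄ ∷ᵉ adj-true e₀₅ ∷ᵉ adj-false ¬e₀₆ ∷ᵉ refl)

      contained : Inside U (c₀ ∷ c₁ ∷ c₂ ∷ c₃ ∷ c₄ ∷ c₅ ∷ c₆ ∷ [])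
      contained = inside λ where
        zero → c₀∈
        (suc zero) → c₁∈
        (suc (suc zero)) → c₂∈
        (suc (suc (suc zero))) → c₃∈
        (suc (suc (suc (suc zero)))) → c₄∈
        (suc (suc (suc (suc (suc zero))))) → c₅∈
        (suc (suc (suc (suc (suc (suc zero)))))) → c₆∈

-- Losing a colour in the whole class

module Class (G : Graph) (no2K₂ : Columns.2K₂-free G)
             (noK₄ : ThreeColouring.K₄-free G) (noC₅ : ThreeColouring.C₅-free G) where

  open Recolouring G
  open Columns G
  open ThreeColouring G using (three-colouring)
  open Codes G
  open Extensions G no2K₂ noK₄ noC₅
  open Comparable G

  module _ {ℓ : ℕ} {L : Pred (Fin ℓ) 0ℓ} (M : Many 5 L) where

    -- Class 0 of `δ` is set aside with `c`; three columns and at least four colours remain.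
    shrink-four-columns : ∀ {U : Pred V 0ℓ} {δ : V → Fin 4} {f c} → Decidable U → ProperOn U δ →
                          Proper U L f → L c → (∀ {u} → U u → f u ≡ c → δ u ≡ zero) → Shrink U L f
    shrink-four-columns {U} {δ} {c = c} U? δ-proper p c∈L class =
      shrink-class U? (λ u → δ u ≟ zero) p
        (λ u v δu δv e → δ-proper u v e (trans δu (sym δv))) c∈L class
        (λ _ → shrink-three-columns no2K₂ (U? ∖? λ u → δ u ≟ zero) γ-proper (many-remove 4 M c))
      where
      γ : V → Fin 3
      γ u with δ u
      ... | zero  = zero
      ... | suc j = j

      γ-proper : ProperOn (U ∖ (λ u → δ u ≡ zero)) γ
      γ-proper {u} {v} (u∈U , δu≢0) (v∈U , δv≢0) e γu≡γv with δ u in δu | δ v in δv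
      ... | zero  | _     = δu≢0 refl
      ... | suc _ | zero  = δv≢0 refl
      ... | suc i | suc j = δ-proper u∈U v∈U e (trans δu (trans (cong suc γu≡γv) (sym δv)))

    module _ {U : Pred V 0ℓ} (U? : Decidable U) {f : V → Fin ℓ} (p : Proper U L f) where

      shrink-spanning : ∀ {m} {A : Code m} {xs : Vec V m} → xs ⊨ A →
                        (∀ {u} → U u → ∃ λ i → u ≡ lookup xs i) →
                        (ρ : Vec (Fin 4) m) → (∀ i j → lookup ρ i ≡ lookup ρ j → entry A i j ≡ false) →
                        ∀ {c} → L c → (∀ i → U (lookup xs i) → f (lookup xs i) ≡ c → lookup ρ i ≡ zero) →
                        Shrink U L f
      shrink-spanning {xs = xs} ⊨A spans ρ ρ-proper c∈L class =
        shrink-four-columns {δ = δ} U? δ-proper p c∈L δ-class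
        where
        δ : V → Fin 4
        δ u with any? (λ i → u ≟ lookup xs i)
        ... | yes (i , _) = lookup ρ i
        -- Junk: every vertex of `U` occurs in `xs`.
        ... | no _        = zero

        position : ∀ {u} → U u → ∃ λ i → u ≡ lookup xs i × δ u ≡ lookup ρ i
        position {u} u∈U with any? (λ i → u ≟ lookup xs i)
        ... | yes (i , eq) = i , eq , refl
        ... | no  new      = contradiction (spans u∈U) new

        δ-proper : ProperOn U δ
        δ-proper u∈U v∈U e δu≡δv with position u∈U | position v∈U
        ... | i , refl , δu | j , refl , δv =
          nonedge (trans (⊨-entry ⊨A i j) (ρ-proper i j (trans (sym δu) (trans δu≡δv δv)))) e

        δ-class : ∀ {u} → U u → f u ≡ _ → δ u ≡ zero
        δ-class u∈U fu≡c with position u∈U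
        ... | i , refl , δu = trans δu (class i u∈U fu≡c)

      module _ (incomparable : ∀ {u v} → u ≢ v → U u → U v → ¬ E u v → ∃ λ w → U w × E u w × ¬ E v w) where

        open Incomparable U? incomparable

        proper-entry : ∀ {m A} {xs : Vec V m} → xs ⊨ A → Inside U xs → ∀ i j →
                       f (lookup xs i) ≡ f (lookup xs j) → entry A i j ≡ false
        proper-entry {xs = xs} ⊨A xs∈U i j eq = trans (sym (⊨-entry ⊨A i j))
          (dec-false (E? (lookup xs i) (lookup xs j)) λ e → separated p (at xs∈U i) (at xs∈U j) e eq)

        shrink-C₇ᶜ : Spanning C₇ᶜ → Shrink U L f
        shrink-C₇ᶜ record { vertices = xs ; realised = ⊨A ; contained = xs∈U ; spanning = spans }
          with f (lookup xs (# 1)) ≟ f (lookup xs (# 0))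
        ... | yes f₁ = shrink-spanning ⊨A spans colours₀₁ colours₀₁-proper (palette p (at xs∈U (# 0)))
          λ i _ eq → colours₀₁-class i (proper-entry ⊨A xs∈U (# 0) i (sym eq))
                       (proper-entry ⊨A xs∈U (# 1) i (trans f₁ (sym eq)))
        ... | no ¬f₁ = shrink-spanning ⊨A spans colours₆₀ colours₆₀-proper (palette p (at xs∈U (# 0)))
          λ i _ eq → colours₆₀-class i (proper-entry ⊨A xs∈U (# 0) i (sym eq))
                       λ { refl → ¬f₁ eq }

        shrink-C₁₁²ᶜ : Spanning C₁₁²ᶜ → Shrink U L f
        shrink-C₁₁²ᶜ record { vertices = xs ; realised = ⊨A ; contained = xs∈U ; spanning = spans }
          with f (lookup xs (# 2)) ≟ f (lookup xs (# 0)) | f (lookup xs (# 1)) ≟ f (lookup xs (# 0))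
        ... | yes f₂ | _ = shrink-spanning ⊨A spans colours₀₁₂ colours₀₁₂-proper (palette p (at xs∈U (# 0)))
          λ i _ eq → colours₀₁₂-class i (proper-entry ⊨A xs∈U (# 0) i (sym eq))
                       (proper-entry ⊨A xs∈U (# 2) i (trans f₂ (sym eq)))
        ... | no ¬f₂ | yes f₁ =
          shrink-spanning ⊨A spans colours₁₀₀₁ colours₁₀₀₁-proper (palette p (at xs∈U (# 0)))
            λ i _ eq → colours₁₀₀₁-class i (proper-entry ⊨A xs∈U (# 0) i (sym eq))
                         (proper-entry ⊨A xs∈U (# 1) i (trans f₁ (sym eq))) λ { refl → ¬f₂ eq }
        ... | no ¬f₂ | no ¬f₁ =
          shrink-spanning ⊨A spans colours₉₁₀₀ colours₉₁₀₀-proper (palette p (at xs∈U (# 0)))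
            λ i _ eq → colours₉₁₀₀-class i (proper-entry ⊨A xs∈U (# 0) i (sym eq))
                         (λ { refl → ¬f₁ eq }) λ { refl → ¬f₂ eq }

        shrink-incomparable : Shrink U L f
        shrink-incomparable with three-colouring no2K₂ noK₄ noC₅ U?
        ... | inj₁ (g , g-proper) =
          shrink-three-columns no2K₂ U? g-proper (many-≤ (s≤s (s≤s (s≤s (s≤s z≤n)))) M) p
        ... | inj₂ h = [ shrink-C₇ᶜ , shrink-C₁₁²ᶜ ] (antihole-spanning h)

    -- `U` is only a predicate, so the induction on its size runs over a list containing it, with
    -- `k` bounding the length.
    shrink-five : ∀ k (xs : List V) → List.length xs ≤ k → ∀ {U : Pred V 0ℓ} {f} → Decidable U →
                  (∀ {u} → U u → u ∈ xs) → Proper U L f → Shrink U L f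
    shrink-five k xs len {U} {f} U? U⊆xs p
      with any? (λ u → any? λ v → ¬? (u ≟ v) ×-dec U? u ×-dec U? v ×-dec ¬? (E? u v) ×-dec
                 all? λ w → U? w →-dec E? u w →-dec E? v w)
    ... | no  none = shrink-incomparable U? p incomparable
      where
      incomparable : ∀ {u v} → u ≢ v → U u → U v → ¬ E u v → ∃ λ w → U w × E u w × ¬ E v w
      incomparable {u} {v} u≢v u∈U v∈U ¬uv =
        decidable-stable (any? λ w → U? w ×-dec E? u w ×-dec ¬? (E? v w)) λ no-w →
          none (u , v , u≢v , u∈U , v∈U , ¬uv , λ w w∈U uw →
            decidable-stable (E? v w) λ ¬vw → no-w (w , w∈U , uw , ¬vw))
    ... | yes (u , v , u≢v , u∈U , v∈U , ¬uv , N⊆N) =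
      shrink-comparable u≢v u∈U v∈U ¬uv (λ {w} → N⊆N w) p (smaller k len)
      where
      keep : ∀ w → Dec (w ≢ u)
      keep w = ¬? (w ≟ u)

      smaller : ∀ k → List.length xs ≤ k → Proper (U ∖ (_≡ u)) L f → Shrink (U ∖ (_≡ u)) L f
      smaller k len = go k (ℕ.<-≤-trans
          (filter-notAll keep xs (Any.map (λ u≡w w≢u → w≢u (sym u≡w)) (U⊆xs u∈U))) len)
        where
        go : ∀ k → List.length (List.filter keep xs) < k →
             Proper (U ∖ (_≡ u)) L f → Shrink (U ∖ (_≡ u)) L f
        go (suc k) (s≤s len) = shrink-five k (List.filter keep xs) len (U? ∖? (_≟ u))
          (λ (w∈U , w≢u) → ∈-filter⁺ keep (U⊆xs w∈U) w≢u)

  three : ℕ → Fin 3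
  three 0 = zero
  three 1 = suc zero
  -- Values from 3 on are junk, excluded by the bounds in `three-injective`.
  three _ = suc (suc zero)

  three-injective : ∀ {i j} → i < 3 → j < 3 → three i ≡ three j → i ≡ j
  three-injective {0} {0} _ _ _ = refl
  three-injective {1} {1} _ _ _ = refl
  three-injective {2} {2} _ _ _ = refl
  three-injective {suc (suc (suc _))} (s≤s (s≤s (s≤s ())))
  three-injective {_} {suc (suc (suc _))} _ (s≤s (s≤s (s≤s ())))

  can-shrink : ∀ {ℓ} → Connectivity.CanShrink G {ℓ}
  can-shrink 0 {f = f} U? γ<k γ-proper (c , c∈L , _) p =
    f , c , ε , c∈L , λ u∈U → contradiction (γ<k u∈U) λ ()
  can-shrink 1 U? γ<k γ-proper M p = shrink-independent U?
    (λ u v e → γ-proper u v e (trans (ℕ.n<1⇒n≡0 (γ<k u)) (sym (ℕ.n<1⇒n≡0 (γ<k v))))) M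
  can-shrink 2 {U} {γ = γ} U? γ<k γ-proper M p =
    shrink-two-columns no2K₂ {t = # 2} U?
      (λ u v e eq → γ-proper u v e (three-injective (ℕ.m<n⇒m<1+n (γ<k u)) (ℕ.m<n⇒m<1+n (γ<k v)) eq))
      (λ u eq → ℕ.<-irrefl (three-injective (ℕ.m<n⇒m<1+n (γ<k u)) ℕ.≤-refl eq) (γ<k u)) M p
  can-shrink 3 U? γ<k γ-proper M p =
    shrink-three-columns no2K₂ U? (λ u v e eq → γ-proper u v e (three-injective (γ<k u) (γ<k v) eq)) M p
  can-shrink (suc (suc (suc (suc k)))) U? γ<k γ-proper M p =
    shrink-five (many-≤ (s≤s (s≤s (s≤s (s≤s (s≤s z≤n))))) M) _ (allFin order) ℕ.≤-refl U?
      (λ {u} _ → ∈-allFin u) p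

-- Forbidden induced subgraphs as conditions on edges

module Embedding (F G : Graph) where

  open Recolouring G

  module FC = Codes F
  open Codes G

  -- Makes an adjacency-preserving and -reflecting map injective.
  TwinFree : Set
  TwinFree = ∀ i j → i ≡ j ⊎ ∃ λ k → Graph.Adj F i k × ¬ Graph.Adj F j k

  twinFree? : Dec TwinFree
  twinFree? = all? λ i → all? λ j →
    i ≟ j ⊎-dec any? λ k → Graph.Adj? F i k ×-dec ¬? (Graph.Adj? F j k)

  codeOf : Code (Graph.order F)
  codeOf = FC.code (Vec.allFin (Graph.order F))

  module _ (twinFree : TwinFree) {xs : Vec V (Graph.order F)} (⊨F : xs ⊨ codeOf) where

    φ : Fin (Graph.order F) → V
    φ = lookup xs

    adj-φ : ∀ i j → adj (φ i) (φ j) ≡ FC.adj i j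
    adj-φ i j = trans (⊨-entry ⊨F i j) (trans (sym (FC.entry-code (Vec.allFin _) i j))
      (cong₂ FC.adj (Vec.lookup-allFin i) (Vec.lookup-allFin j)))

    to-E : ∀ {i j} → Graph.Adj F i j → E (φ i) (φ j)
    to-E {i} {j} e = edge (trans (adj-φ i j) (dec-true (Graph.Adj? F i j) e))

    from-E : ∀ {i j} → E (φ i) (φ j) → Graph.Adj F i j
    from-E {i} {j} e = FC.edge (trans (sym (adj-φ i j)) (dec-true (E? (φ i) (φ j)) e))

    φ-injective : ∀ {i j} → φ i ≡ φ j → i ≡ j
    φ-injective {i} {j} eq with twinFree i j
    ... | inj₁ i≡j = i≡j
    ... | inj₂ (k , ik , ¬jk) = contradiction (from-E (subst (λ x → E x (φ k)) eq (to-E ik))) ¬jk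

    image? : ∀ v → Dec (∃ λ i → v ≡ φ i)
    image? v = any? λ i → v ≟ φ i

    support : Subset order
    support = Vec.tabulate (does ∘ image?)

    ∈-support : ∀ i → φ i Subset.∈ support
    ∈-support i = Vec.lookup⇒[]= (φ i) support
      (trans (Vec.lookup∘tabulate (does ∘ image?) (φ i)) (dec-true (image? (φ i)) (i , refl)))

    support-∈ : ∀ {v} → v Subset.∈ support → ∃ λ i → v ≡ φ i
    support-∈ {v} v∈ with image? v
                        | trans (sym (Vec.lookup∘tabulate (does ∘ image?) v)) (Vec.[]=⇒lookup v∈)
    ... | yes found | _ = found

    induced : ∃ λ S → F ≅ G [ S ]
    induced = support , record
      { bijection = mk↔ₛ′ (λ i → φ i , ∈-support i) (λ (_ , v∈) → proj₁ (support-∈ v∈))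
          (λ (_ , v∈) → same (sym (proj₂ (support-∈ v∈))))
          (λ i → φ-injective (sym (proj₂ (support-∈ (∈-support i)))))
      ; adjacency = λ _ _ → mk⇔ to-E from-E
      }
      where
      same : ∀ {x z : Σ V (Subset._∈ support)} → proj₁ x ≡ proj₁ z → x ≡ z
      same {u , u∈} {_ , u∈′} refl rewrite Vec.[]=-irrelevant u∈ u∈′ = refl

module Patterns (G : Graph) where

  open Recolouring G
  open Codes G

  2K₂-pattern : ¬ (∃ λ S → 2K₂ ≅ G [ S ]) → Columns.2K₂-free G
  2K₂-pattern free ab cd ¬ac ¬ad ¬bc ¬bd =
    free (induced (from-yes twinFree?) (⊨-∷ (⊨-∷ (⊨-∷ (⊨-∷ (realises refl) refl)
      (adj-true cd ∷ᵉ refl)) (adj-false ¬bc ∷ᵉ adj-false ¬bd ∷ᵉ refl)) (adj-true ab ∷ᵉ adj-false ¬ac ∷ᵉ adj-false ¬ad ∷ᵉ refl)))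
    where open Embedding 2K₂ G

  K₄-pattern : ¬ (∃ λ S → K 4 ≅ G [ S ]) → ThreeColouring.K₄-free G
  K₄-pattern free ab ac ad bc bd cd =
    free (induced (from-yes twinFree?) (⊨-∷ (⊨-∷ (⊨-∷ (⊨-∷ (realises refl) refl)
      (adj-true cd ∷ᵉ refl)) (adj-true bc ∷ᵉ adj-true bd ∷ᵉ refl)) (adj-true ab ∷ᵉ adj-true ac ∷ᵉ adj-true ad ∷ᵉ refl)))
    where open Embedding (K 4) G

  C₅-pattern : ¬ (∃ λ S → C₅ ≅ G [ S ]) → ThreeColouring.C₅-free G
  C₅-pattern free ab bc cd de ea ¬ac ¬ad ¬bd ¬be ¬ce =
    free (induced (from-yes twinFree?) (⊨-∷ (⊨-∷ (⊨-∷ (⊨-∷ (⊨-∷ (realises refl) refl)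
      (adj-true de ∷ᵉ refl)) (adj-true cd ∷ᵉ adj-false ¬ce ∷ᵉ refl)) (adj-true bc ∷ᵉ adj-false ¬bd ∷ᵉ adj-false ¬be ∷ᵉ refl))
      (adj-true ab ∷ᵉ adj-false ¬ac ∷ᵉ adj-false ¬ad ∷ᵉ adj-true (E-sym ea) ∷ᵉ refl)))
    where open Embedding C₅ G

-- Return to the reconfiguration graph

module Colourings (G : Graph) {ℓ : ℕ} where

  open Recolouring G

  Full : ∀ {A : Set} → Pred A 0ℓ
  Full _ = ⊤

  colouring-proper : (α : Colouring G ℓ) → Proper Full Full (colour α)
  colouring-proper α = (λ _ → tt) , λ _ _ → proper α

  recolourings : ∀ {f g} → Proper Full Full f → Reach Full Full f g →
                 (α : Colouring G ℓ) → colour α ≗ f → ∃ λ γ → Star Recolour α γ × colour γ ≗ g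
  recolourings p ε α α≗f = α , ε , α≗f
  recolourings {f} p (_◅_ {j = h} s r) α α≗f with h (vertex s) ≟ f (vertex s)
  -- A null step is no edge of the reconfiguration graph, so it is dropped; `α` represents `h` as
  -- well as `f`.
  ... | yes same = recolourings (step-proper s p) r α α≗h
    where
    α≗h : colour α ≗ h
    α≗h v with v ≟ vertex s
    ... | yes refl = trans (α≗f v) (sym same)
    ... | no  v≢x  = trans (α≗f v) (sym (others s v≢x))
  ... | no  new  =
    let γ , r′ , γ≗g = recolourings (step-proper s p) r β (λ _ → refl) in γ , change ◅ r′ , γ≗g
    where
    β : Colouring G ℓ
    β = record { colour = h ; proper = separated (step-proper s p) tt tt }

    change : Recolour α β
    change = vertex s , (λ eq → new (trans (sym eq) (α≗f (vertex s)))) , λ {y} differ →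
      decidable-stable (vertex s ≟ y) λ x≢y →
        differ (trans (α≗f y) (sym (others s (x≢y ∘ sym))))

theorem1p5 : ∀ (G : Graph) → Free (2K₂ ∷ K 4 ∷ C₅ ∷ []) G → Recolourable G
theorem1p5 G (no2K₂ All.∷ noK₄ All.∷ noC₅ All.∷ All.[]) χ (κ , _) ℓ χ<ℓ α β =
  let g , r , g≡β     = connected can-shrink χ {γ = toℕ ∘ colour κ} (λ _ → yes tt)
                          (λ {u} _ → toℕ<n (colour κ u)) (λ _ _ e eq → proper κ e (toℕ-injective eq))
                          (many-≤ χ<ℓ (many-full ℓ)) (colouring-proper α) (colouring-proper β)
      γ , path , γ≗g = recolourings (colouring-proper α) r α (λ _ → refl)
  in  γ , path , λ v → trans (γ≗g v) (g≡β tt)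
  where
  open Patterns G
  open Class G (2K₂-pattern no2K₂) (K₄-pattern noK₄) (C₅-pattern noC₅)
  open Connectivity G
  open Colourings G
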